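{- Let $\mathfrak{X}=(X,C)$ be a homogeneous coherent configuration, $D$ a closed subset of $C$, and $\varphi$ an irreducible character of $D$ of multiplicity one. Let $e_\varphi\in\mathbb{C}D\subset M_X(\mathbb{C})$ be the central primitive idempotent of $\mathbb{C}D$ corresponding to $\varphi$, let $\Gamma:e_\varphi\,\mathbb{C}C\,e_\varphi\to M_{X/D}(\mathbb{C})$ be the algebra homomorphism defined in the context, choose representatives $c_\lambda\in C$ ($\lambda\in\Lambda$) such that $C/\!/D=\{c_\lambda^D\mid\lambda\in\Lambda\}$, $c_\lambda^D\neq c_{\lambda'}^D$ for $\lambda\neq\lambda'$, and such that $e_\varphi A_{c_\lambda}e_\varphi\neq 0$ whenever some $c\in C$ with $c^D=c_\lambda^D$ satisfies $e_\varphi A_ce_\varphi\neq 0$. Then $$W=\sum_{\lambda\in\Lambda}\Gamma(e_\varphi A_{c_\lambda}e_\varphi)\in M_{X/D}(\mathbb{C})$$ is a weight on the factor homogeneous coherent configuration $(X/D,C/\!/D)$.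
   Context: For a finite set $X$, $M_X(\mathbb{C})$ is the algebra of complex matrices with rows and columns indexed by $X$. For $c\subset X\times X$, $A_c$ is its $0/1$ adjacency matrix and $c^*=\{(y,x)\mid(x,y)\in c\}$. A homogeneous coherent configuration is a pair $\mathfrak{X}=(X,C)$ where $C$ is a partition of $X\times X$ into non-empty subsets, $c\in C$ implies $c^*\in C$, the diagonal $\{(x,x)\mid x\in X\}$ belongs to $C$, and $\mathbb{C}C=\bigoplus_{c\in C}\mathbb{C}A_c$ is an algebra (the adjacency algebra; it is semisimple). A weight on $\mathfrak{X}=(X,C)$ is a matrix $W\in M_X(\mathbb{C})$ such that, with $\mathrm{spt}(W)=\{(x,y)\mid W_{xy}\neq0\}$ and $A_c^W=A_c\circ W$ (entrywise product): (W1) $\mathrm{spt}(W)$ is a union of members of $C$, and for $d\in C$, $d\subset\mathrm{spt}(W)$ implies $d^*\subset\mathrm{spt}(W)$; (W2) $W_{xx}\neq0$ for all $x\in X$; (W3) the linear span $\bigoplus_{c\in C}\mathbb{C}A_c^W$ is an algebra (closed under matrix multiplication). A (non-empty) subset $D\subset C$ is closed if $\mathbb{C}D=\bigoplus_{d\in D}\mathbb{C}A_d$ is a subalgebra of $\mathbb{C}C$. For $x\in X$ put $xD=\{y\in X\mid(x,y)\in d\text{ for some }d\in D\}$; these sets partition $X$ as $X=x_1D\cup\dots\cup x_mD$, and all have the same size $\ell$. Put $X/D=\{x_1D,\dots,x_mD\}$, $c^D=\{(x_iD,x_jD)\mid c\cap(x_iD\times x_jD)\neq\emptyset\}$ for $c\in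 C$, and $C/\!/D=\{c^D\mid c\in C\}$. Then $(X/D,C/\!/D)$ is a homogeneous coherent configuration, the factor homogeneous coherent configuration. For each $i$, $(x_iD,\{d\cap(x_iD\times x_iD)\mid d\in D\})$ is a homogeneous coherent configuration whose adjacency algebra is isomorphic to $\mathbb{C}D$ via restriction to the block $x_iD$. An irreducible character of $D$ is an irreducible character $\varphi$ of the algebra $\mathbb{C}D$; its multiplicity $m_\varphi$ is its multiplicity in the character of the standard module $\mathbb{C}(x_iD)$ (independent of $i$). Assume $m_\varphi=1$. Then, as an element of $M_X(\mathbb{C})$, $e_\varphi$ is block diagonal with respect to $X=x_1D\cup\dots\cup x_mD$, and its diagonal blocks have rank one. As in the paper, the elements of each $x_iD$ are ordered (each $x_iD$ is identified with $\{1,\dots,\ell\}$) in such a way that all diagonal blocks of $e_\varphi$ are one and the same matrix $e\in M_\ell(\mathbb{C})$; such orderings exist by a known theorem of Hirasaka and Muzychuk. Since $eM_\ell(\mathbb{C})e=\mathbb{C}e$, every element of $e_\varphi\,\mathbb{C}C\,e_\varphi$ has the block form $(a_{ij}e)_{1\le i,j\le m}$ with $a_{ij}\in\mathbb{C}$, and $\Gamma:e_\varphi\,\mathbb{C}C\,e_\varphi\to M_{X/D}(\mathbb{C})$ is the algebra homomorphism sending it to the matrix with $(x_iD,x_jD)$-entry $a_{ij}$. -}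

module Defs where

open import Level using (0ℓ)
open import Algebra.Bundles using (CommutativeRing)
import Algebra.Properties.Ring as RingProperties
import Algebra.Properties.Semiring.Sum as SemiringSum
import Algebra.Properties.Monoid.Mult as MonoidMult
import Algebra.Solver.Ring.NaturalCoefficients.Default as SemiringSolver
open import Data.Bool.Base using (Bool; T; if_then_else_)
open import Data.Bool.Properties using (T?)
open import Data.Fin.Base using (Fin)
open import Data.Fin.Properties using (_≟_; any?)
open import Data.Fin.Subset using (Subset; _∈_; _∉_; Nonempty)
open import Data.Nat.Base using (ℕ)
open import Data.Product.Base using (∃; ∃₂; _×_; _,_)
open import Data.Sum.Base using (_⊎_)
open import Function.Base using (flip)
open import Function.Bundles using (_↔_; _⇔_; Inverse)
open import Relation.Binary.Core using (Rel)
open import Relation.Binary.PropositionalEquality.Core using (_≡_)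
open import Relation.Binary.Structures using (IsStrictTotalOrder)
open import Relation.Nullary using (¬_)
open import Relation.Nullary.Decidable using (⌊_⌋)
open import Relation.Unary using (Pred)

-- The real numbers, axiomatised as a Dedekind-complete ordered field.
-- Such a field is unique up to isomorphism, so quantifying over this
-- record is quantifying over presentations of ℝ.

record Reals : Set₁ where
  field
    commutativeRing : CommutativeRing 0ℓ 0ℓ

  open CommutativeRing commutativeRing public

  infix 4 _<_
  field
    _<_                : Rel Carrier 0ℓ
    isStrictTotalOrder : IsStrictTotalOrder _≈_ _<_
    0<1                : 0# < 1#
    +-monoˡ-<          : ∀ z {x y} → x < y → x + z < y + z
    *-pos              : ∀ {x y} → 0# < x → 0# < y → 0# < x * y
    inverse            : ∀ x → ¬ (x ≈ 0#) → ∃ λ y → x * y ≈ 1#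

  infix 4 _≤_
  _≤_ : Rel Carrier 0ℓ
  x ≤ y = ¬ (y < x)

  UpperBound : Pred Carrier 0ℓ → Pred Carrier 0ℓ
  UpperBound P b = ∀ x → P x → x ≤ b

  field
    supremum : (P : Pred Carrier 0ℓ) → ∃ P → ∃ (UpperBound P) →
               ∃ λ s → UpperBound P s × (∀ b → UpperBound P b → s ≤ b)

-- ℂ = ℝ[i]: the pair (a , b) is a + b i.

module Complex (ℝ : Reals) where
  private
    module R = Reals ℝ
    open R using (_+_; _*_; -_; 0#; 1#; _≈_)
    open SemiringSolver R.commutativeSemiring using (solve; con; _:+_; _:*_; _:=_)

  ℂ : Set
  ℂ = R.Carrier × R.Carrier

  private
    _≈ᶜ_ : Rel ℂ 0ℓ
    (a , b) ≈ᶜ (c , d) = a ≈ c × b ≈ d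

    _+ᶜ_ _*ᶜ_ : ℂ → ℂ → ℂ
    (a , b) +ᶜ (c , d) = a + c , b + d
    (a , b) *ᶜ (c , d) = (a * c) + (- (b * d)) , (a * d) + (b * c)

    -ᶜ_ : ℂ → ℂ
    -ᶜ (a , b) = - a , - b

    -- The semiring solver has no negation, so -1# enters the identities
    -- below as a variable n.
    -≈ : ∀ x → - x ≈ (- 1#) * x
    -≈ x = R.sym (RingProperties.-1*x≈-x R.ring x)

    assoc-re′ : ∀ n a b c d e f →
      (((a * c) + (n * (b * d))) * e) + (n * (((a * d) + (b * c)) * f)) ≈
      (a * ((c * e) + (n * (d * f)))) + (n * (b * ((c * f) + (d * e))))
    assoc-re′ = solve 7 (λ n a b c d e f →
      ((((a :* c) :+ (n :* (b :* d))) :* e) :+ (n :* (((a :* d) :+ (b :* c)) :* f))) :=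
      ((a :* ((c :* e) :+ (n :* (d :* f)))) :+ (n :* (b :* ((c :* f) :+ (d :* e)))))) R.refl

    assoc-im′ : ∀ n a b c d e f →
      (((a * c) + (n * (b * d))) * f) + (((a * d) + (b * c)) * e) ≈
      (a * ((c * f) + (d * e))) + (b * ((c * e) + (n * (d * f))))
    assoc-im′ = solve 7 (λ n a b c d e f →
      ((((a :* c) :+ (n :* (b :* d))) :* f) :+ (((a :* d) :+ (b :* c)) :* e)) :=
      ((a :* ((c :* f) :+ (d :* e))) :+ (b :* ((c :* e) :+ (n :* (d :* f)))))) R.refl

    distribˡ-re′ : ∀ n a b c d e f →
      (a * (c + e)) + (n * (b * (d + f))) ≈
      ((a * c) + (n * (b * d))) + ((a * e) + (n * (b * f)))
    distribˡ-re′ = solve 7 (λ n a b c d e f →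
      ((a :* (c :+ e)) :+ (n :* (b :* (d :+ f)))) :=
      (((a :* c) :+ (n :* (b :* d))) :+ ((a :* e) :+ (n :* (b :* f))))) R.refl

    distribˡ-im : ∀ a b c d e f →
      (a * (d + f)) + (b * (c + e)) ≈
      ((a * d) + (b * c)) + ((a * f) + (b * e))
    distribˡ-im = solve 6 (λ a b c d e f →
      ((a :* (d :+ f)) :+ (b :* (c :+ e))) :=
      (((a :* d) :+ (b :* c)) :+ ((a :* f) :+ (b :* e)))) R.refl

    identityˡ-re′ : ∀ n a b → (1# * a) + (n * (0# * b)) ≈ a
    identityˡ-re′ = solve 3 (λ n a b →
      ((con 1 :* a) :+ (n :* (con 0 :* b))) :=
      (a)) R.refl

    identityˡ-im : ∀ a b → (1# * b) + (0# * a) ≈ b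
    identityˡ-im = solve 2 (λ a b →
      ((con 1 :* b) :+ (con 0 :* a)) :=
      (b)) R.refl

    comm-im : ∀ a b c d → (a * d) + (b * c) ≈ (c * b) + (d * a)
    comm-im = solve 4 (λ a b c d →
      ((a :* d) :+ (b :* c)) :=
      ((c :* b) :+ (d :* a))) R.refl

    sub : ∀ x y → x + (- y) ≈ x + ((- 1#) * y)
    sub x y = R.+-congˡ (-≈ y)

    assoc-re : ∀ a b c d e f →
      (((a * c) + (- (b * d))) * e) + (- (((a * d) + (b * c)) * f)) ≈
      (a * ((c * e) + (- (d * f)))) + (- (b * ((c * f) + (d * e))))
    assoc-re a b c d e f =
      R.trans (R.+-cong (R.*-congʳ (sub _ _)) (-≈ _))
        (R.trans (assoc-re′ (- 1#) a b c d e f)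
          (R.sym (R.+-cong (R.*-congˡ (sub _ _)) (-≈ _))))

    assoc-im : ∀ a b c d e f →
      (((a * c) + (- (b * d))) * f) + (((a * d) + (b * c)) * e) ≈
      (a * ((c * f) + (d * e))) + (b * ((c * e) + (- (d * f))))
    assoc-im a b c d e f =
      R.trans (R.+-congʳ (R.*-congʳ (sub _ _)))
        (R.trans (assoc-im′ (- 1#) a b c d e f)
          (R.sym (R.+-congˡ (R.*-congˡ (sub _ _)))))

    distribˡ-re : ∀ a b c d e f →
      (a * (c + e)) + (- (b * (d + f))) ≈
      ((a * c) + (- (b * d))) + ((a * e) + (- (b * f)))
    distribˡ-re a b c d e f =
      R.trans (sub _ _)
        (R.trans (distribˡ-re′ (- 1#) a b c d e f)
          (R.sym (R.+-cong (sub _ _) (sub _ _))))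

    identityˡ-re : ∀ a b → (1# * a) + (- (0# * b)) ≈ a
    identityˡ-re a b = R.trans (sub _ _) (identityˡ-re′ (- 1#) a b)

    comm-re : ∀ a b c d → (a * c) + (- (b * d)) ≈ (c * a) + (- (d * b))
    comm-re a b c d = R.+-cong (R.*-comm a c) (R.-‿cong (R.*-comm b d))

    *ᶜ-cong : ∀ {x y u v} → x ≈ᶜ y → u ≈ᶜ v → (x *ᶜ u) ≈ᶜ (y *ᶜ v)
    *ᶜ-cong (p , q) (r , s) =
      R.+-cong (R.*-cong p r) (R.-‿cong (R.*-cong q s)) ,
      R.+-cong (R.*-cong p s) (R.*-cong q r)

    *ᶜ-comm : ∀ x y → (x *ᶜ y) ≈ᶜ (y *ᶜ x)
    *ᶜ-comm (a , b) (c , d) = comm-re a b c d , comm-im a b c d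

    *ᶜ-identityˡ : ∀ x → ((1# , 0#) *ᶜ x) ≈ᶜ x
    *ᶜ-identityˡ (a , b) = identityˡ-re a b , identityˡ-im a b

    ≈ᶜ-trans : ∀ {x y z} → x ≈ᶜ y → y ≈ᶜ z → x ≈ᶜ z
    ≈ᶜ-trans (p , q) (r , s) = R.trans p r , R.trans q s

    distribˡᶜ : ∀ x y z → (x *ᶜ (y +ᶜ z)) ≈ᶜ ((x *ᶜ y) +ᶜ (x *ᶜ z))
    distribˡᶜ (a , b) (c , d) (e , f) =
      distribˡ-re a b c d e f , distribˡ-im a b c d e f

    +ᶜ-cong : ∀ {x y u v} → x ≈ᶜ y → u ≈ᶜ v → (x +ᶜ u) ≈ᶜ (y +ᶜ v)
    +ᶜ-cong (p , q) (r , s) = R.+-cong p r , R.+-cong q s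

  ℂ-commutativeRing : CommutativeRing 0ℓ 0ℓ
  ℂ-commutativeRing = record
    { Carrier = ℂ
    ; _≈_ = _≈ᶜ_
    ; _+_ = _+ᶜ_
    ; _*_ = _*ᶜ_
    ; -_  = -ᶜ_
    ; 0#  = 0# , 0#
    ; 1#  = 1# , 0#
    ; isCommutativeRing = record
      { isRing = record
        { +-isAbelianGroup = record
          { isGroup = record
            { isMonoid = record
              { isSemigroup = record
                { isMagma = record
                  { isEquivalence = record
                    { refl  = R.refl , R.refl
                    ; sym   = λ (p , q) → R.sym p , R.sym q
                    ; trans = ≈ᶜ-trans
                    }
                  ; ∙-cong = +ᶜ-cong
                  }
                ; assoc = λ (a , b) (c , d) (e , f) →
                    R.+-assoc a c e , R.+-assoc b d f
                }
              ; identity =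
                  (λ (a , b) → R.+-identityˡ a , R.+-identityˡ b) ,
                  (λ (a , b) → R.+-identityʳ a , R.+-identityʳ b)
              }
            ; inverse =
                (λ (a , b) → R.-‿inverseˡ a , R.-‿inverseˡ b) ,
                (λ (a , b) → R.-‿inverseʳ a , R.-‿inverseʳ b)
            ; ⁻¹-cong = λ (p , q) → R.-‿cong p , R.-‿cong q
            }
          ; comm = λ (a , b) (c , d) → R.+-comm a c , R.+-comm b d
          }
        ; *-cong = *ᶜ-cong
        ; *-assoc = λ (a , b) (c , d) (e , f) →
            assoc-re a b c d e f , assoc-im a b c d e f
        ; *-identity =
            *ᶜ-identityˡ ,
            (λ x → ≈ᶜ-trans (*ᶜ-comm x (1# , 0#)) (*ᶜ-identityˡ x))
        ; distrib =
            distribˡᶜ ,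
            (λ x y z → ≈ᶜ-trans (*ᶜ-comm (y +ᶜ z) x)
              (≈ᶜ-trans (distribˡᶜ x y z)
                (+ᶜ-cong (*ᶜ-comm x y) (*ᶜ-comm x z))))
        }
      ; *-comm = *ᶜ-comm
      }
    }

module Configurations (ℝ : Reals) where
  open Complex ℝ public using (ℂ; ℂ-commutativeRing)
  open CommutativeRing ℂ-commutativeRing public
    using (_≈_; _+_; _*_; -_; 0#; 1#; semiring; +-monoid)
  open SemiringSum semiring public using (sum)
  open MonoidMult +-monoid public using () renaming (_×_ to _·_)

  infix 4 _≉_
  _≉_ : Rel ℂ 0ℓ
  x ≉ y = ¬ (x ≈ y)

  Matrix : ℕ → Set
  Matrix n = Fin n → Fin n → ℂ

  infix  4 _≋_
  infixl 6 _⊞_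
  infixl 7 _⊠_ _∘ᴴ_
  infixr 7 _⊡_

  _≋_ : ∀ {n} → Matrix n → Matrix n → Set
  A ≋ B = ∀ x y → A x y ≈ B x y

  𝟘 : ∀ {n} → Matrix n
  𝟘 _ _ = 0#

  𝟙 : ∀ {n} → Matrix n
  𝟙 x y = if ⌊ x ≟ y ⌋ then 1# else 0#

  _⊞_ _⊠_ _∘ᴴ_ : ∀ {n} → Matrix n → Matrix n → Matrix n
  (A ⊞ B) x y = A x y + B x y
  (A ⊠ B) x y = sum λ z → A x z * B z y
  (A ∘ᴴ B) x y = A x y * B x y

  _⊡_ : ∀ {n} → ℂ → Matrix n → Matrix n
  (a ⊡ A) x y = a * A x y

  trace : ∀ {n} → Matrix n → ℂ
  trace A = sum λ x → A x x

  infixr 8 _▹_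
  _▹_ : ∀ {n} → Matrix n → (Fin n → ℂ) → (Fin n → ℂ)
  (A ▹ v) x = sum λ y → A x y * v y

  linComb : ∀ {n r} → (Fin r → ℂ) → (Fin r → Matrix n) → Matrix n
  linComb a F x y = sum λ c → a c * F c x y

  Span : ∀ {n r} → (Fin r → Matrix n) → Pred (Matrix n) 0ℓ
  Span F M = ∃ λ a → M ≋ linComb a F

  SpanOn : ∀ {n r} → Subset r → (Fin r → Matrix n) → Pred (Matrix n) 0ℓ
  SpanOn D F M = ∃ λ a → (∀ c → c ∉ D → a c ≈ 0#) × M ≋ linComb a F

  MultiplicativelyClosed : ∀ {n} → Pred (Matrix n) 0ℓ → Set
  MultiplicativelyClosed 𝒜 = ∀ A B → 𝒜 A → 𝒜 B → 𝒜 (A ⊠ B)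

  Relation : ℕ → Set
  Relation n = Fin n → Fin n → Bool

  infix 4 _≐_
  _≐_ : ∀ {n} → Relation n → Relation n → Set
  c ≐ d = ∀ x y → c x y ≡ d x y

  adj : ∀ {n} → Relation n → Matrix n
  adj c x y = if c x y then 1# else 0#

  -- X is Fin n.  A finite set C of relations on X is given as a family
  -- indexed by Fin r.  For a partition into non-empty parts, disjointness
  -- of distinctly indexed members makes the indexing injective.

  record IsHomogeneousCC {n r} (C : Fin r → Relation n) : Set where
    field
      nonempty : ∀ c → ∃₂ λ x y → T (C c x y)
      covering : ∀ x y → ∃ λ c → T (C c x y)
      disjoint : ∀ {c d x y} → T (C c x y) → T (C d x y) → c ≡ d
      transpose : ∀ c → ∃ λ d → C d ≐ flip (C c)
      diagonal : ∃ λ c → C c ≐ (λ x y → ⌊ x ≟ y ⌋)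
      algebra  : MultiplicativelyClosed (Span λ c → adj (C c))

  record IsWeight {n r} (C : Fin r → Relation n) (W : Matrix n) : Set where
    field
      support           : ∃ λ (S : Subset r) →
                          ∀ x y → (W x y ≉ 0#) ⇔ (∃ λ c → c ∈ S × T (C c x y))
      support-transpose : ∀ d → (∀ x y → T (C d x y) → W x y ≉ 0#) →
                          ∀ x y → T (flip (C d) x y) → W x y ≉ 0#
      diagonal          : ∀ x → W x x ≉ 0#
      algebra           : MultiplicativelyClosed (Span λ c → adj (C c) ∘ᴴ W)

  -- Characters of a matrix algebra 𝒜 (a subalgebra of Matrix n that
  -- contains 𝟙).  Functions on 𝒜 are total functions on Matrix n whose
  -- values outside 𝒜 are irrelevant.

  record IsRepresentation {n} (𝒜 : Pred (Matrix n) 0ℓ) {k}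
                          (ρ : Matrix n → Matrix k) : Set where
    field
      cong   : ∀ A B → 𝒜 A → 𝒜 B → A ≋ B → ρ A ≋ ρ B
      ⊞-homo : ∀ A B → 𝒜 A → 𝒜 B → ρ (A ⊞ B) ≋ ρ A ⊞ ρ B
      ⊡-homo : ∀ a A → 𝒜 A → ρ (a ⊡ A) ≋ a ⊡ ρ A
      ⊠-homo : ∀ A B → 𝒜 A → 𝒜 B → ρ (A ⊠ B) ≋ ρ A ⊠ ρ B
      𝟙-homo : ρ 𝟙 ≋ 𝟙

  record IsSubmodule {n} (𝒜 : Pred (Matrix n) 0ℓ) {k}
                     (ρ : Matrix n → Matrix k)
                     (U : Pred (Fin k → ℂ) 0ℓ) : Set where
    field
      respects  : ∀ {u v} → (∀ i → u i ≈ v i) → U u → U v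
      zero∈     : U (λ _ → 0#)
      +-closed  : ∀ {u v} → U u → U v → U (λ i → u i + v i)
      *-closed  : ∀ a {u} → U u → U (λ i → a * u i)
      invariant : ∀ A → 𝒜 A → ∀ {u} → U u → U (ρ A ▹ u)

  record IsIrreducible {n} (𝒜 : Pred (Matrix n) 0ℓ) {k}
                       (ρ : Matrix n → Matrix k) : Set₁ where
    field
      nontrivial : ¬ (k ≡ 0)
      simple     : ∀ (U : Pred (Fin k → ℂ) 0ℓ) → IsSubmodule 𝒜 ρ U →
                   (∃ λ u → U u × ∃ λ i → u i ≉ 0#) → ∀ v → U v

  record IsIrreducibleCharacter {n} (𝒜 : Pred (Matrix n) 0ℓ)
                                (φ : Matrix n → ℂ) : Set₁ where
    field
      degree           : ℕ
      ρ                : Matrix n → Matrix degree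
      isRepresentation : IsRepresentation 𝒜 ρ
      isIrreducible    : IsIrreducible 𝒜 ρ
      character        : ∀ A → 𝒜 A → φ A ≈ trace (ρ A)

  -- φ occurs with multiplicity k in the character χ of 𝒜: χ is a sum of
  -- distinct irreducible characters with multiplicities, and the one of
  -- φ is k.  (Irreducible characters are linearly independent, so k is
  -- determined by φ and χ.)

  record HasMultiplicity {n} (𝒜 : Pred (Matrix n) 0ℓ)
                         (φ χ : Matrix n → ℂ) (k : ℕ) : Set₁ where
    field
      size          : ℕ
      ψ             : Fin size → Matrix n → ℂ
      irreducible   : ∀ t → IsIrreducibleCharacter 𝒜 (ψ t)
      distinct      : ∀ s t → (∀ A → 𝒜 A → ψ s A ≈ ψ t A) → s ≡ t
      mult          : Fin size → ℕ
      decomposition : ∀ A → 𝒜 A → χ A ≈ sum λ t → mult t · ψ t A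
      index         : Fin size
      index-φ       : ∀ A → 𝒜 A → ψ index A ≈ φ A
      mult-φ        : mult index ≡ k

  record IsCentralIdempotent {n} (𝒜 : Pred (Matrix n) 0ℓ)
                             (e : Matrix n) : Set where
    field
      member     : 𝒜 e
      central    : ∀ A → 𝒜 A → e ⊠ A ≋ A ⊠ e
      idempotent : e ⊠ e ≋ e

  record IsCentralPrimitiveIdempotent {n} (𝒜 : Pred (Matrix n) 0ℓ)
                                      (e : Matrix n) : Set where
    field
      isCentralIdempotent : IsCentralIdempotent 𝒜 e
      nonzero             : ¬ (e ≋ 𝟘)
      indecomposable      : ∀ f g → IsCentralIdempotent 𝒜 f →
                            IsCentralIdempotent 𝒜 g →
                            f ⊠ g ≋ 𝟘 → e ≋ f ⊞ g → f ≋ 𝟘 ⊎ g ≋ 𝟘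

  -- The second field says that e acts as the identity on the irreducible
  -- module affording φ.

  record IsCentralPrimitiveIdempotentOf {n} (𝒜 : Pred (Matrix n) 0ℓ)
           (φ : Matrix n → ℂ) (e : Matrix n) : Set where
    field
      isCentralPrimitiveIdempotent : IsCentralPrimitiveIdempotent 𝒜 e
      corresponds                  : ∀ A → 𝒜 A → φ (e ⊠ A) ≈ φ A

  module _ {n r} (C : Fin r → Relation n) where

    adjacencyAlgebra : Pred (Matrix n) 0ℓ
    adjacencyAlgebra = Span λ c → adj (C c)

    subsetAlgebra : Subset r → Pred (Matrix n) 0ℓ
    subsetAlgebra D = SpanOn D λ c → adj (C c)

    record IsClosed (D : Subset r) : Set where
      field
        nonempty   : Nonempty D
        subalgebra : MultiplicativelyClosed (subsetAlgebra D)

  -- A bijection β enumerates X as m blocks of size ℓ: its value at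
  -- (i , k) is the k-th element of the i-th block.  X/D is represented
  -- by Fin m.

  module _ {n m ℓ} (β : (Fin m × Fin ℓ) ↔ Fin n) where

    point : Fin m → Fin ℓ → Fin n
    point i k = Inverse.to β (i , k)

    block : Matrix n → Fin m → Fin m → Matrix ℓ
    block M i j k l = M (point i k) (point j l)

    standardCharacter : Fin m → Matrix n → ℂ
    standardCharacter i A = trace (block A i i)

    -- c^D = {(x_iD , x_jD) ∣ c ∩ (x_iD × x_jD) ≠ ∅}
    factor : Relation n → Relation m
    factor c i j = ⌊ any? (λ k → any? λ l → T? (c (point i k) (point j l))) ⌋

    -- The blocks of β are exactly the sets xD.
    AreCosets : ∀ {r} → (Fin r → Relation n) → Subset r → Set
    AreCosets C D = ∀ i k j l →
      (∃ λ d → d ∈ D × T (C d (point i k) (point j l))) ⇔ (i ≡ j)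

    -- Γ sends the element of e_φ (ℂC) e_φ with block form (a_ij e) to
    -- the matrix (a_ij).  As e ≠ 0, this determines Γ on e_φ (ℂC) e_φ; it is
    -- a total function whose values elsewhere are irrelevant.
    IsΓ : ∀ {r} → (Fin r → Relation n) → Matrix n → Matrix ℓ →
          (Matrix n → Matrix m) → Set
    IsΓ C eφ e Γ = ∀ B → (∃ λ A → adjacencyAlgebra C A × B ≋ eφ ⊠ A ⊠ eφ) →
                   ∀ i j → block B i j ≋ Γ B i j ⊡ e

    -- c_λ = rep λ for λ in Λ = Fin q.
    record AreRepresentatives {r q} (C : Fin r → Relation n) (eφ : Matrix n)
                              (rep : Fin q → Fin r) : Set where
      field
        complete     : ∀ c → ∃ λ λ′ → factor (C c) ≐ factor (C (rep λ′))
        irredundant  : ∀ λ₁ λ₂ → factor (C (rep λ₁)) ≐ factor (C (rep λ₂)) → λ₁ ≡ λ₂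
        nonvanishing : ∀ λ′ c → factor (C c) ≐ factor (C (rep λ′)) →
                       ¬ (eφ ⊠ adj (C c) ⊠ eφ ≋ 𝟘) →
                       ¬ (eφ ⊠ adj (C (rep λ′)) ⊠ eφ ≋ 𝟘)

{-# OPTIONS --safe #-}

-- An element of the adjacency algebra is a matrix that is constant on the classes of C.  Two
-- classes with the same image in C//D meet the same blocks x_iD × x_jD, so such a matrix is
-- determined, on all blocks of a given c^D, by any single one of these blocks.  Applied to
-- E A_c E, where E = e_φ and all blocks are multiples of e, this shows that E A_c E is zero or
-- has a non-zero coefficient at every block of c^D, and that the elements of E (ℂC) E
-- restricted to c^D are proportional.  Hence N = (a_ij) is in the span of the A_{c^D} ∘ W iff
-- N ⊗ e is in ℂC, a condition that is closed under multiplication since e² = e.  The support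
-- is closed under transposition because (E A_c E)* = E A_{c*} E, E being hermitian.
module Submission where

open import Defs
open import Level using (0ℓ)
open import Algebra.Bundles using (CommutativeRing)
import Algebra.Properties.AbelianGroup as AbelianGroupProperties
import Algebra.Properties.Ring as RingProperties
import Algebra.Properties.CommutativeSemigroup as CommutativeSemigroupProperties
import Algebra.Properties.Semiring.Sum as SemiringSum
open import Data.Bool.Base using (Bool; true; false; T; if_then_else_)
open import Data.Bool.Properties using (T?; T-≡; ⇔→≡)
open import Data.Fin.Base using (Fin; zero; suc)
open import Data.Fin.Properties using (_≟_; any?; all?; ¬∀⟶∃¬; suc-injective)
open import Data.Fin.Subset using (Subset; _∈_; _∉_)
open import Data.Nat.Base using (ℕ; zero; suc)
open import Data.Product.Base using (∃; ∃₂; _×_; _,_; proj₁; proj₂)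
open import Data.Sum.Base using (_⊎_; inj₁; inj₂; [_,_]′)
open import Data.Vec.Base using (tabulate)
open import Data.Vec.Properties using (lookup⇒[]=; []=⇒lookup; lookup∘tabulate)
open import Function.Base using (_∘_; flip)
open import Function.Bundles using (_↔_; _⇔_; mk⇔; Inverse; Equivalence)
import Function.Properties.Equivalence as ⇔
open import Relation.Binary.Bundles using (Setoid)
open import Relation.Binary.PropositionalEquality.Core as ≡ using (_≡_; _≢_)
open import Relation.Binary.Definitions using (tri<; tri≈; tri>)
open import Relation.Binary.Structures using (IsStrictTotalOrder)
import Relation.Binary.Reasoning.Setoid as SetoidReasoning
open import Relation.Nullary using (¬_; Dec; yes; no)
open import Relation.Nullary.Decidable
  using (_×-dec_; ⌊_⌋; toWitness; fromWitness; decidable-stable; ¬?)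
open import Relation.Nullary.Negation using (contradiction)
open import Relation.Unary using (Pred)

-- That two classes with one block in common meet exactly the same blocks rests on positivity. An
-- entry of A_c A_d counts paths, is constant on classes, and is zero only if there is no path; so a
-- path between the ends of one pair of a class can be carried to any other pair of that class.
--
-- The delicate direction leads from N ⊗ e back to N. The matrix N ⊗ e is a combination of E A_c E
-- over all classes c, whereas W sees only the representatives. Where W is zero, N has to be zero
-- too, and this is what the choice of representatives secures. The same choice gives the diagonal
-- of W, since the diagonal class yields E² = E ≠ 0, and the symmetry of the support, since the
-- converse of a representative may fail to be a representative.
--
-- That C//D is a homogeneous coherent configuration is proved by the same lifting, with the
-- all-ones block in place of e. Its square is ℓ times itself, so a factor ℓ has to be cancelled.

-- All that the proof uses of ℂ.  Anisotropy stands in for positivity; since b b̄ = b for a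
-- 0/1 entry b, it also says that a sum of such entries vanishes only if each of them does.
record ConjugationField : Set₁ where
  field
    commutativeRing : CommutativeRing 0ℓ 0ℓ

  open CommutativeRing commutativeRing public
  open SemiringSum semiring public

  infix 8 _̄
  field
    _≈?_        : (x y : Carrier) → Dec (x ≈ y)
    1≉0         : ¬ (1# ≈ 0#)
    inverse     : ∀ x → ¬ (x ≈ 0#) → ∃ λ y → x * y ≈ 1#
    _̄           : Carrier → Carrier
    ̄-cong       : ∀ {x y} → x ≈ y → x ̄ ≈ y ̄
    ̄-involutive : ∀ x → x ̄ ̄ ≈ x
    ̄-0          : 0# ̄ ≈ 0#
    ̄-1          : 1# ̄ ≈ 1#
    ̄-+          : ∀ x y → (x + y) ̄ ≈ x ̄ + y ̄
    ̄-*          : ∀ x y → (x * y) ̄ ≈ x ̄ * y ̄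
    anisotropic : ∀ {k} (f : Fin k → Carrier) → sum (λ i → f i * f i ̄) ≈ 0# →
                  ∀ i → f i ≈ 0#

-- Matrix algebra over a field with an anisotropic conjugation.

module Matrices (𝔽 : ConjugationField) where
  open ConjugationField 𝔽 hiding (zero)
  open RingProperties ring using (-‿distribˡ-*; -‿distribʳ-*)
  open AbelianGroupProperties +-abelianGroup using (⁻¹-∙-comm; x∙y⁻¹≈ε⇒x≈y)
  open CommutativeSemigroupProperties *-commutativeSemigroup using (interchange)
  open SetoidReasoning setoid

  *-zero-ˡ : ∀ {x} y → x ≈ 0# → x * y ≈ 0#
  *-zero-ˡ y x≈0 = trans (*-congʳ x≈0) (zeroˡ y)

  *-zero-ʳ : ∀ x {y} → y ≈ 0# → x * y ≈ 0#
  *-zero-ʳ x y≈0 = trans (*-congˡ y≈0) (zeroʳ x)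

  *-cancelʳ : ∀ {x y z} → ¬ (z ≈ 0#) → x * z ≈ y * z → x ≈ y
  *-cancelʳ {x} {y} {z} z≉0 xz≈yz with inverse z z≉0
  ... | w , zw≈1 = begin
    x            ≈⟨ undo x ⟨
    (x * z) * w  ≈⟨ *-congʳ xz≈yz ⟩
    (y * z) * w  ≈⟨ undo y ⟩
    y            ∎
    where
    undo : ∀ u → (u * z) * w ≈ u
    undo u = trans (*-assoc u z w) (trans (*-congˡ zw≈1) (*-identityʳ u))

  sum-≈0 : ∀ {k} (f : Fin k → Carrier) → (∀ i → f i ≈ 0#) → sum f ≈ 0#
  sum-≈0 {k} f f≈0 = trans (sum-cong-≋ f≈0) (sum-replicate-zero k)

  sum-single : ∀ {k} (f : Fin k → Carrier) i → (∀ j → j ≢ i → f j ≈ 0#) → sum f ≈ f i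
  sum-single f zero f≈0 =
    trans (+-congˡ (sum-≈0 (f ∘ suc) (λ j → f≈0 (suc j) λ ()))) (+-identityʳ (f zero))
  sum-single f (suc i) f≈0 =
    trans (+-cong (f≈0 zero λ ())
            (sum-single (f ∘ suc) i λ j j≢i → f≈0 (suc j) (j≢i ∘ suc-injective)))
          (+-identityˡ (f (suc i)))

  ̄-sum : ∀ {k} (f : Fin k → Carrier) → (sum f) ̄ ≈ sum λ i → f i ̄
  ̄-sum {zero} f = ̄-0
  ̄-sum {suc k} f = trans (̄-+ (f zero) (sum (f ∘ suc))) (+-congˡ (̄-sum (f ∘ suc)))

  -‿sum : ∀ {k} (f : Fin k → Carrier) → - sum f ≈ sum λ i → - f i
  -‿sum {zero} f = AbelianGroupProperties.ε⁻¹≈ε +-abelianGroup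
  -‿sum {suc k} f =
    trans (sym (⁻¹-∙-comm (f zero) (sum (f ∘ suc)))) (+-congˡ (-‿sum (f ∘ suc)))

  bit : Bool → Carrier
  bit b = if b then 1# else 0#

  bit-true : ∀ {b} → T b → bit b ≈ 1#
  bit-true {true} _ = refl

  bit-false : ∀ {b} → ¬ T b → bit b ≈ 0#
  bit-false {true} ¬b = contradiction _ ¬b
  bit-false {false} _ = refl

  bit*bit≉0 : ∀ {a b} → T a → T b → ¬ (bit a * bit b ≈ 0#)
  bit*bit≉0 {true} {true} _ _ 1*1≈0 = 1≉0 (trans (sym (*-identityˡ 1#)) 1*1≈0)

  bit-normalised : ∀ b → bit b * bit b ̄ ≈ bit b
  bit-normalised true  = trans (*-identityˡ (1# ̄)) ̄-1
  bit-normalised false = zeroˡ (0# ̄)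

  bit*bit-normalised : ∀ a b → (bit a * bit b) * (bit a * bit b) ̄ ≈ bit a * bit b
  bit*bit-normalised a b = begin
    (bit a * bit b) * (bit a * bit b) ̄      ≈⟨ *-congˡ (̄-* (bit a) (bit b)) ⟩
    (bit a * bit b) * (bit a ̄ * bit b ̄)     ≈⟨ interchange (bit a) (bit b) (bit a ̄) (bit b ̄) ⟩
    (bit a * bit a ̄) * (bit b * bit b ̄)     ≈⟨ *-cong (bit-normalised a) (bit-normalised b) ⟩
    bit a * bit b                           ∎

  -- Such a sum is an entry of a product of two adjacency matrices, that is, a number of paths of
  -- length two; `path-transport` uses this to find a path from a non-zero count.
  sum-bits≈0 : ∀ {k} (a b : Fin k → Bool) → sum (λ i → bit (a i) * bit (b i)) ≈ 0# →
               ∀ i → bit (a i) * bit (b i) ≈ 0#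
  sum-bits≈0 a b s≈0 = anisotropic _
    (trans (sum-cong-≋ λ i → bit*bit-normalised (a i) (b i)) s≈0)

  Matrix : ℕ → Set
  Matrix n = Fin n → Fin n → Carrier

  infix  4 _≋_
  infixl 6 _⊞_ _⊟_
  infixl 7 _⊠_ _∘ᴴ_
  infixr 7 _⊡_
  infix  8 _†

  _≋_ : ∀ {n} → Matrix n → Matrix n → Set
  A ≋ B = ∀ x y → A x y ≈ B x y

  𝟘 𝟙 : ∀ {n} → Matrix n
  𝟘 _ _ = 0#
  𝟙 x y = bit ⌊ x ≟ y ⌋

  _⊞_ _⊟_ _⊠_ _∘ᴴ_ : ∀ {n} → Matrix n → Matrix n → Matrix n
  (A ⊞ B) x y = A x y + B x y
  (A ⊟ B) x y = A x y - B x y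
  (A ⊠ B) x y = sum λ z → A x z * B z y
  (A ∘ᴴ B) x y = A x y * B x y

  _⊡_ : ∀ {n} → Carrier → Matrix n → Matrix n
  (a ⊡ A) x y = a * A x y

  _† : ∀ {n} → Matrix n → Matrix n
  (A †) x y = A y x ̄

  linComb : ∀ {n r} → (Fin r → Carrier) → (Fin r → Matrix n) → Matrix n
  linComb a F x y = sum λ c → a c * F c x y

  Span : ∀ {n r} → (Fin r → Matrix n) → Pred (Matrix n) 0ℓ
  Span F M = ∃ λ a → M ≋ linComb a F

  SpanOn : ∀ {n r} → Subset r → (Fin r → Matrix n) → Pred (Matrix n) 0ℓ
  SpanOn D F M = ∃ λ a → (∀ c → c ∉ D → a c ≈ 0#) × M ≋ linComb a F

  MultiplicativelyClosed : ∀ {n} → Pred (Matrix n) 0ℓ → Set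
  MultiplicativelyClosed 𝒜 = ∀ A B → 𝒜 A → 𝒜 B → 𝒜 (A ⊠ B)

  ≋-setoid : ℕ → Setoid 0ℓ 0ℓ
  ≋-setoid n = record
    { Carrier       = Matrix n
    ; _≈_           = _≋_
    ; isEquivalence = record
      { refl  = λ _ _ → refl
      ; sym   = λ A≋B x y → sym (A≋B x y)
      ; trans = λ A≋B B≋C x y → trans (A≋B x y) (B≋C x y)
      }
    }

  module ≋ {n} = Setoid (≋-setoid n)

  _≋𝟘? : ∀ {n} (A : Matrix n) → Dec (A ≋ 𝟘)
  A ≋𝟘? = all? λ x → all? λ y → A x y ≈? 0#

  ≋𝟘-nonzeroEntry : ∀ {n} (A : Matrix n) → ¬ (A ≋ 𝟘) → ∃₂ λ x y → ¬ (A x y ≈ 0#)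
  ≋𝟘-nonzeroEntry A A≉𝟘 with ¬∀⟶∃¬ _ _ (λ x → all? λ y → A x y ≈? 0#) A≉𝟘
  ... | x , row≉0 with ¬∀⟶∃¬ _ _ (λ y → A x y ≈? 0#) row≉0
  ...   | y , Axy≉0 = x , y , Axy≉0

  module _ {n : ℕ} where
    private
      variable A A′ B B′ : Matrix n

    ⊠-cong : A ≋ A′ → B ≋ B′ → A ⊠ B ≋ A′ ⊠ B′
    ⊠-cong A≋A′ B≋B′ x y = sum-cong-≋ λ (z : Fin n) → *-cong (A≋A′ x z) (B≋B′ z y)

    ⊠-congˡ : B ≋ B′ → A ⊠ B ≋ A ⊠ B′
    ⊠-congˡ = ⊠-cong ≋.refl

    ⊠-congʳ : A ≋ A′ → A ⊠ B ≋ A′ ⊠ B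
    ⊠-congʳ A≋A′ = ⊠-cong A≋A′ ≋.refl

    ⊠-assoc : ∀ A B C → (A ⊠ B) ⊠ C ≋ A ⊠ (B ⊠ C)
    ⊠-assoc A B C x y = begin
      sum (λ z → sum (λ w → A x w * B w z) * C z y)
        ≈⟨ sum-cong-≋ (λ (z : Fin n) → trans (*-distribʳ-sum (C z y) (λ w → A x w * B w z))
                                   (sum-cong-≋ λ (w : Fin n) → *-assoc (A x w) (B w z) (C z y))) ⟩
      sum (λ z → sum λ w → A x w * (B w z * C z y))
        ≈⟨ ∑-comm (λ z w → A x w * (B w z * C z y)) ⟩
      sum (λ w → sum λ z → A x w * (B w z * C z y))
        ≈⟨ sum-cong-≋ (λ (w : Fin n) → *-distribˡ-sum (A x w) (λ z → B w z * C z y)) ⟨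
      sum (λ w → A x w * sum λ z → B w z * C z y) ∎

    ⊠-distribˡ-⊟ : ∀ A B C → A ⊠ (B ⊟ C) ≋ A ⊠ B ⊟ A ⊠ C
    ⊠-distribˡ-⊟ A B C x y = begin
      sum (λ z → A x z * (B z y - C z y))
        ≈⟨ sum-cong-≋ (λ (z : Fin n) → trans (distribˡ (A x z) (B z y) (- C z y))
                                   (+-congˡ (sym (-‿distribʳ-* (A x z) (C z y))))) ⟩
      sum (λ z → A x z * B z y + - (A x z * C z y))
        ≈⟨ ∑-distrib-+ (λ z → A x z * B z y) (λ z → - (A x z * C z y)) ⟩
      (A ⊠ B) x y + sum (λ z → - (A x z * C z y))
        ≈⟨ +-congˡ (-‿sum (λ z → A x z * C z y)) ⟨
      (A ⊠ B) x y - (A ⊠ C) x y ∎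

    ⊠-distribʳ-⊟ : ∀ A B C → (B ⊟ C) ⊠ A ≋ B ⊠ A ⊟ C ⊠ A
    ⊠-distribʳ-⊟ A B C x y = begin
      sum (λ z → (B x z - C x z) * A z y)
        ≈⟨ sum-cong-≋ (λ (z : Fin n) → trans (distribʳ (A z y) (B x z) (- C x z))
                                   (+-congˡ (sym (-‿distribˡ-* (C x z) (A z y))))) ⟩
      sum (λ z → B x z * A z y + - (C x z * A z y))
        ≈⟨ ∑-distrib-+ (λ z → B x z * A z y) (λ z → - (C x z * A z y)) ⟩
      (B ⊠ A) x y + sum (λ z → - (C x z * A z y))
        ≈⟨ +-congˡ (-‿sum (λ z → C x z * A z y)) ⟨
      (B ⊠ A) x y - (C ⊠ A) x y ∎

    ⊟-cong : A ≋ A′ → B ≋ B′ → A ⊟ B ≋ A′ ⊟ B′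
    ⊟-cong A≋A′ B≋B′ x y = +-cong (A≋A′ x y) (-‿cong (B≋B′ x y))

    A⊟A≋𝟘 : ∀ A → A ⊟ A ≋ 𝟘 {n}
    A⊟A≋𝟘 A x y = -‿inverseʳ (A x y)

    A⊟𝟘≋A : ∀ A → A ⊟ 𝟘 {n} ≋ A
    A⊟𝟘≋A A x y = trans (+-congˡ (AbelianGroupProperties.ε⁻¹≈ε +-abelianGroup)) (+-identityʳ (A x y))

    B⊞[A⊟B]≋A : ∀ (A B : Matrix n) → B ⊞ (A ⊟ B) ≋ A
    B⊞[A⊟B]≋A A B x y = begin
      B x y + (A x y - B x y)    ≈⟨ +-comm (B x y) (A x y - B x y) ⟩
      (A x y - B x y) + B x y    ≈⟨ +-assoc (A x y) (- B x y) (B x y) ⟩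
      A x y + (- B x y + B x y)  ≈⟨ +-congˡ (-‿inverseˡ (B x y)) ⟩
      A x y + 0#                 ≈⟨ +-identityʳ (A x y) ⟩
      A x y                      ∎

    A⊟B≋𝟘⇒A≋B : A ⊟ B ≋ 𝟘 → A ≋ B
    A⊟B≋𝟘⇒A≋B {A} {B} A⊟B≋𝟘 x y = x∙y⁻¹≈ε⇒x≈y (A x y) (B x y) (A⊟B≋𝟘 x y)

    𝟙⊠A≋A : ∀ (A : Matrix n) → 𝟙 ⊠ A ≋ A
    𝟙⊠A≋A A x y = begin
      sum (λ z → 𝟙 x z * A z y)
        ≈⟨ sum-single (λ z → 𝟙 x z * A z y) x
             (λ z z≢x → *-zero-ˡ (A z y) (bit-false {⌊ x ≟ z ⌋} (z≢x ∘ ≡.sym ∘ toWitness))) ⟩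
      𝟙 x x * A x y
        ≈⟨ *-congʳ (bit-true {⌊ x ≟ x ⌋} (fromWitness ≡.refl)) ⟩
      1# * A x y
        ≈⟨ *-identityˡ (A x y) ⟩
      A x y ∎

    A⊠𝟙≋A : ∀ (A : Matrix n) → A ⊠ 𝟙 ≋ A
    A⊠𝟙≋A A x y = begin
      sum (λ z → A x z * 𝟙 z y)
        ≈⟨ sum-single (λ z → A x z * 𝟙 z y) y
             (λ z z≢y → *-zero-ʳ (A x z) (bit-false {⌊ z ≟ y ⌋} (z≢y ∘ toWitness))) ⟩
      A x y * 𝟙 y y
        ≈⟨ *-congˡ (bit-true {⌊ y ≟ y ⌋} (fromWitness ≡.refl)) ⟩
      A x y * 1#
        ≈⟨ *-identityʳ (A x y) ⟩
      A x y ∎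

    †-cong : A ≋ B → A † ≋ B †
    †-cong A≋B x y = ̄-cong (A≋B y x)

    †-involutive : ∀ (A : Matrix n) → A † † ≋ A
    †-involutive A x y = ̄-involutive (A x y)

    †-⊠ : ∀ A B → (A ⊠ B) † ≋ B † ⊠ A †
    †-⊠ A B x y = begin
      sum (λ z → A y z * B z x) ̄
        ≈⟨ ̄-sum (λ z → A y z * B z x) ⟩
      sum (λ z → (A y z * B z x) ̄)
        ≈⟨ sum-cong-≋ (λ (z : Fin n) → trans (̄-* (A y z) (B z x)) (*-comm (A y z ̄) (B z x ̄))) ⟩
      sum (λ z → B z x ̄ * A y z ̄) ∎

    -- The diagonal entries of `A ⊠ A †` are the hermitian norms of the rows of `A`.
    A⊠A†≋𝟘⇒A≋𝟘 : A ⊠ A † ≋ 𝟘 → A ≋ 𝟘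
    A⊠A†≋𝟘⇒A≋𝟘 {A} AA†≋𝟘 x = anisotropic (A x) (AA†≋𝟘 x x)

    ⊠-linComb : ∀ {r} A (a : Fin r → Carrier) (F : Fin r → Matrix n) →
                A ⊠ linComb a F ≋ linComb a (λ c → A ⊠ F c)
    ⊠-linComb {r} A a F x y = begin
      sum (λ z → A x z * sum λ c → a c * F c z y)
        ≈⟨ sum-cong-≋ (λ (z : Fin n) → trans (*-distribˡ-sum (A x z) (λ c → a c * F c z y))
             (sum-cong-≋ λ (c : Fin r) → x∙yz≈y∙xz (A x z) (a c) (F c z y))) ⟩
      sum (λ z → sum λ c → a c * (A x z * F c z y))
        ≈⟨ ∑-comm (λ z c → a c * (A x z * F c z y)) ⟩
      sum (λ c → sum λ z → a c * (A x z * F c z y))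
        ≈⟨ sum-cong-≋ (λ (c : Fin r) → *-distribˡ-sum (a c) (λ z → A x z * F c z y)) ⟨
      linComb a (λ c → A ⊠ F c) x y ∎
      where open CommutativeSemigroupProperties *-commutativeSemigroup using (x∙yz≈y∙xz)

    linComb-⊠ : ∀ {r} A (a : Fin r → Carrier) (F : Fin r → Matrix n) →
                linComb a F ⊠ A ≋ linComb a (λ c → F c ⊠ A)
    linComb-⊠ {r} A a F x y = begin
      sum (λ z → sum (λ c → a c * F c x z) * A z y)
        ≈⟨ sum-cong-≋ (λ (z : Fin n) → trans (*-distribʳ-sum (A z y) (λ c → a c * F c x z))
             (sum-cong-≋ λ (c : Fin r) → *-assoc (a c) (F c x z) (A z y))) ⟩
      sum (λ z → sum λ c → a c * (F c x z * A z y))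
        ≈⟨ ∑-comm (λ z c → a c * (F c x z * A z y)) ⟩
      sum (λ c → sum λ z → a c * (F c x z * A z y))
        ≈⟨ sum-cong-≋ (λ (c : Fin r) → *-distribˡ-sum (a c) (λ z → F c x z * A z y)) ⟨
      linComb a (λ c → F c ⊠ A) x y ∎

-- Central idempotents of a matrix algebra closed under the adjoint.

module CentralIdempotents (𝔽 : ConjugationField) {n} (𝒜 : Pred (Matrices.Matrix 𝔽 n) 0ℓ)
  (⊠-closed : ∀ {A B} → 𝒜 A → 𝒜 B → 𝒜 (Matrices._⊠_ 𝔽 A B))
  (⊟-closed : ∀ {A B} → 𝒜 A → 𝒜 B → 𝒜 (Matrices._⊟_ 𝔽 A B))
  (†-closed : ∀ {A} → 𝒜 A → 𝒜 (Matrices._† 𝔽 A)) where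

  open Matrices 𝔽
  open SetoidReasoning (≋-setoid n)

  record CentralIdempotent (f : Matrix n) : Set where
    field
      member     : 𝒜 f
      central    : ∀ A → 𝒜 A → f ⊠ A ≋ A ⊠ f
      idempotent : f ⊠ f ≋ f

  open CentralIdempotent

  †-centralIdempotent : ∀ {f} → CentralIdempotent f → CentralIdempotent (f †)
  †-centralIdempotent {f} f-ci .member = †-closed (f-ci .member)
  †-centralIdempotent {f} f-ci .central A A∈ = begin
    f † ⊠ A        ≈⟨ ⊠-congˡ {A = f †} (†-involutive A) ⟨
    f † ⊠ A † †    ≈⟨ †-⊠ (A †) f ⟨
    (A † ⊠ f) †    ≈⟨ †-cong (f-ci .central (A †) (†-closed A∈)) ⟨
    (f ⊠ A †) †    ≈⟨ †-⊠ f (A †) ⟩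
    A † † ⊠ f †    ≈⟨ ⊠-congʳ {B = f †} (†-involutive A) ⟩
    A ⊠ f †        ∎
  †-centralIdempotent {f} f-ci .idempotent =
    ≋.trans (≋.sym (†-⊠ f f)) (†-cong (f-ci .idempotent))

  module _ {f g : Matrix n} (f-ci : CentralIdempotent f) (g-ci : CentralIdempotent g) where
    ⊠-centralIdempotent : CentralIdempotent (f ⊠ g)
    ⊠-centralIdempotent .member = ⊠-closed (f-ci .member) (g-ci .member)
    ⊠-centralIdempotent .central A A∈ = begin
      (f ⊠ g) ⊠ A  ≈⟨ ⊠-assoc f g A ⟩
      f ⊠ (g ⊠ A)  ≈⟨ ⊠-congˡ {A = f} (g-ci .central A A∈) ⟩
      f ⊠ (A ⊠ g)  ≈⟨ ⊠-assoc f A g ⟨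
      (f ⊠ A) ⊠ g  ≈⟨ ⊠-congʳ {B = g} (f-ci .central A A∈) ⟩
      (A ⊠ f) ⊠ g  ≈⟨ ⊠-assoc A f g ⟩
      A ⊠ (f ⊠ g)  ∎
    ⊠-centralIdempotent .idempotent = begin
      (f ⊠ g) ⊠ (f ⊠ g)  ≈⟨ ⊠-assoc f g (f ⊠ g) ⟩
      f ⊠ (g ⊠ (f ⊠ g))  ≈⟨ ⊠-congˡ {A = f} (⊠-assoc g f g) ⟨
      f ⊠ ((g ⊠ f) ⊠ g)  ≈⟨ ⊠-congˡ {A = f} (⊠-congʳ {B = g} (g-ci .central f (f-ci .member))) ⟩
      f ⊠ ((f ⊠ g) ⊠ g)  ≈⟨ ⊠-congˡ {A = f} (⊠-assoc f g g) ⟩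
      f ⊠ (f ⊠ (g ⊠ g))  ≈⟨ ⊠-assoc f f (g ⊠ g) ⟨
      (f ⊠ f) ⊠ (g ⊠ g)  ≈⟨ ⊠-cong (f-ci .idempotent) (g-ci .idempotent) ⟩
      f ⊠ g              ∎

    f⊠fg≋fg : f ⊠ (f ⊠ g) ≋ f ⊠ g
    f⊠fg≋fg = ≋.trans (≋.sym (⊠-assoc f f g)) (⊠-congʳ {B = g} (f-ci .idempotent))

    fg⊠f≋fg : (f ⊠ g) ⊠ f ≋ f ⊠ g
    fg⊠f≋fg = ≋.trans (⊠-centralIdempotent .central f (f-ci .member)) f⊠fg≋fg

    -- By centrality `f ⊠ g` absorbs `f`, and it is idempotent, so both terms of the expansion are
    -- `f ⊠ g`.
    fg⊠[f⊟fg]≋𝟘 : (f ⊠ g) ⊠ (f ⊟ f ⊠ g) ≋ 𝟘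
    fg⊠[f⊟fg]≋𝟘 = begin
      (f ⊠ g) ⊠ (f ⊟ f ⊠ g)
        ≈⟨ ⊠-distribˡ-⊟ (f ⊠ g) f (f ⊠ g) ⟩
      (f ⊠ g) ⊠ f ⊟ (f ⊠ g) ⊠ (f ⊠ g)
        ≈⟨ ⊟-cong fg⊠f≋fg (⊠-centralIdempotent .idempotent) ⟩
      f ⊠ g ⊟ f ⊠ g
        ≈⟨ A⊟A≋𝟘 (f ⊠ g) ⟩
      𝟘 ∎

    ⊟-centralIdempotent : CentralIdempotent (f ⊟ f ⊠ g)
    ⊟-centralIdempotent .member = ⊟-closed (f-ci .member) (⊠-centralIdempotent .member)
    ⊟-centralIdempotent .central A A∈ = begin
      (f ⊟ f ⊠ g) ⊠ A      ≈⟨ ⊠-distribʳ-⊟ A f (f ⊠ g) ⟩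
      f ⊠ A ⊟ (f ⊠ g) ⊠ A  ≈⟨ ⊟-cong (f-ci .central A A∈) (⊠-centralIdempotent .central A A∈) ⟩
      A ⊠ f ⊟ A ⊠ (f ⊠ g)  ≈⟨ ⊠-distribˡ-⊟ A f (f ⊠ g) ⟨
      A ⊠ (f ⊟ f ⊠ g)      ∎
    ⊟-centralIdempotent .idempotent = begin
      (f ⊟ f ⊠ g) ⊠ (f ⊟ f ⊠ g)
        ≈⟨ ⊠-distribʳ-⊟ (f ⊟ f ⊠ g) f (f ⊠ g) ⟩
      f ⊠ (f ⊟ f ⊠ g) ⊟ (f ⊠ g) ⊠ (f ⊟ f ⊠ g)
        ≈⟨ ⊟-cong (⊠-distribˡ-⊟ f f (f ⊠ g)) fg⊠[f⊟fg]≋𝟘 ⟩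
      (f ⊠ f ⊟ f ⊠ (f ⊠ g)) ⊟ 𝟘
        ≈⟨ A⊟𝟘≋A (f ⊠ f ⊟ f ⊠ (f ⊠ g)) ⟩
      f ⊠ f ⊟ f ⊠ (f ⊠ g)
        ≈⟨ ⊟-cong (f-ci .idempotent) f⊠fg≋fg ⟩
      f ⊟ f ⊠ g ∎

  -- Splitting E = E E† + (E − E E†), primitivity leaves E = E E†, because E E† = 0 would
  -- force E = 0.
  primitive⇒hermitian : ∀ {E} → CentralIdempotent E → ¬ (E ≋ 𝟘) →
    (∀ f g → CentralIdempotent f → CentralIdempotent g → f ⊠ g ≋ 𝟘 → E ≋ f ⊞ g → f ≋ 𝟘 ⊎ g ≋ 𝟘) →
    E † ≋ E
  primitive⇒hermitian {E} E-ci E≉𝟘 indecomposable =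
    [ (λ EE†≋𝟘 → contradiction (A⊠A†≋𝟘⇒A≋𝟘 EE†≋𝟘) E≉𝟘)
    , (λ E⊟EE†≋𝟘 → hermitian (A⊟B≋𝟘⇒A≋B E⊟EE†≋𝟘))
    ]′ (indecomposable (E ⊠ E †) (E ⊟ E ⊠ E †)
          (⊠-centralIdempotent E-ci E†-ci) (⊟-centralIdempotent E-ci E†-ci)
          (fg⊠[f⊟fg]≋𝟘 E-ci E†-ci) (≋.sym (B⊞[A⊟B]≋A E (E ⊠ E †))))
    where
    E†-ci : CentralIdempotent (E †)
    E†-ci = †-centralIdempotent E-ci
    -- A product of the form `E ⊠ E †` is always self-adjoint.
    hermitian : E ≋ E ⊠ E † → E † ≋ E
    hermitian E≋EE† = begin
      E †           ≈⟨ †-cong E≋EE† ⟩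
      (E ⊠ E †) †   ≈⟨ †-⊠ E (E †) ⟩
      E † † ⊠ E †   ≈⟨ ⊠-congʳ {B = E †} (†-involutive E) ⟩
      E ⊠ E †       ≈⟨ E≋EE† ⟨
      E             ∎

module Schemes (𝔽 : ConjugationField) where
  open ConjugationField 𝔽 hiding (zero)
  open Matrices 𝔽
  open CommutativeSemigroupProperties *-commutativeSemigroup using (interchange)
  open SetoidReasoning setoid

  Relation : ℕ → Set
  Relation n = Fin n → Fin n → Bool

  infix 4 _≐_
  _≐_ : ∀ {n} → Relation n → Relation n → Set
  c ≐ d = ∀ x y → c x y ≡ d x y

  ≐-transport : ∀ {n} {c d : Relation n} → c ≐ d → ∀ {x y} → T (c x y) → T (d x y)
  ≐-transport c≐d {x} {y} = ≡.subst T (c≐d x y)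

  T⇔T⇒≡ : ∀ {a b} → (T a → T b) → (T b → T a) → a ≡ b
  T⇔T⇒≡ {a} {b} a⇒b b⇒a = ⇔→≡ {z = true} (⇔.trans (⇔.sym T-≡) (⇔.trans (mk⇔ a⇒b b⇒a) T-≡))

  adj : ∀ {n} → Relation n → Matrix n
  adj c x y = bit (c x y)

  -- Matrices constant on the classes of a partition.

  module Partition {n r} (C : Fin r → Relation n)
    (nonempty : ∀ c → ∃₂ λ x y → T (C c x y))
    (covering : ∀ x y → ∃ λ c → T (C c x y))
    (disjoint : ∀ {c d x y} → T (C c x y) → T (C d x y) → c ≡ d) where

    -- A form of membership in the span of the adjacency matrices that mentions no coefficients, so
    -- that it can be checked and used entry by entry.
    ConstantOnClasses : Pred (Matrix n) 0ℓ
    ConstantOnClasses M = ∀ {c x y x′ y′} → T (C c x y) → T (C c x′ y′) → M x y ≈ M x′ y′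

    -- The classes are disjoint, so at an entry of `c` every other summand vanishes. Stated for any
    -- family supported on the classes, to serve plain and weighted adjacency matrices alike.
    linComb-on-class : ∀ a (F : Fin r → Matrix n) →
      (∀ {c x y} → ¬ T (C c x y) → F c x y ≈ 0#) →
      ∀ {c x y} → T (C c x y) → linComb a F x y ≈ a c * F c x y
    linComb-on-class a F F-off {c} {x} {y} xy∈c =
      sum-single (λ d → a d * F d x y) c λ d d≢c →
        *-zero-ʳ (a d) (F-off (λ xy∈d → d≢c (disjoint xy∈d xy∈c)))

    linComb-adj : ∀ a {c x y} → T (C c x y) → linComb a (λ c → adj (C c)) x y ≈ a c
    linComb-adj a {c} {x} {y} xy∈c = begin
      linComb a (λ c → adj (C c)) x y  ≈⟨ linComb-on-class a _ bit-false xy∈c ⟩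
      a c * bit (C c x y)              ≈⟨ *-congˡ (bit-true xy∈c) ⟩
      a c * 1#                         ≈⟨ *-identityʳ (a c) ⟩
      a c                              ∎

    linComb-weighted : ∀ W a {c x y} → T (C c x y) →
                       linComb a (λ c → adj (C c) ∘ᴴ W) x y ≈ a c * W x y
    linComb-weighted W a {c} {x} {y} xy∈c = begin
      linComb a (λ c → adj (C c) ∘ᴴ W) x y
        ≈⟨ linComb-on-class a (λ c → adj (C c) ∘ᴴ W)
             (λ {c} {x} {y} xy∉c → *-zero-ˡ (W x y) (bit-false xy∉c)) xy∈c ⟩
      a c * (bit (C c x y) * W x y)
        ≈⟨ *-congˡ (trans (*-congʳ (bit-true xy∈c)) (*-identityˡ (W x y))) ⟩
      a c * W x y ∎

    Span⇒ConstantOnClasses : ∀ {M} → Span (λ c → adj (C c)) M → ConstantOnClasses M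
    Span⇒ConstantOnClasses {M} (a , M≋a) {c} {x} {y} {x′} {y′} xy∈c x′y′∈c = begin
      M x y    ≈⟨ M≋a x y ⟩
      _        ≈⟨ linComb-adj a xy∈c ⟩
      a c      ≈⟨ linComb-adj a x′y′∈c ⟨
      _        ≈⟨ M≋a x′ y′ ⟨
      M x′ y′  ∎

    -- The coefficient of the class in `M`, read off at the pair that witnesses that the class is
    -- non-empty. It is meaningful once `M` is constant on classes.
    valueOn : Matrix n → Fin r → Carrier
    valueOn M c = M (proj₁ (nonempty c)) (proj₁ (proj₂ (nonempty c)))

    ConstantOnClasses⇒linComb : ∀ {M} → ConstantOnClasses M →
                                M ≋ linComb (valueOn M) (λ c → adj (C c))
    ConstantOnClasses⇒linComb {M} constM x y with covering x y
    ... | c , xy∈c = trans (constM xy∈c (proj₂ (proj₂ (nonempty c))))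
                           (sym (linComb-adj (valueOn M) xy∈c))

    ConstantOnClasses⇒Span : ∀ {M} → ConstantOnClasses M → Span (λ c → adj (C c)) M
    ConstantOnClasses⇒Span {M} constM = valueOn M , ConstantOnClasses⇒linComb constM

    multipleOnClasses⇒Span : ∀ {M} W a → (∀ {c x y} → T (C c x y) → M x y ≈ a c * W x y) →
                             Span (λ c → adj (C c) ∘ᴴ W) M
    multipleOnClasses⇒Span W a M≈aW = a , λ x y →
      let c , xy∈c = covering x y in trans (M≈aW xy∈c) (sym (linComb-weighted W a xy∈c))

  -- Block matrices, Kronecker products and block diagonal matrices.

  module Blocks {n m ℓ} (β : (Fin m × Fin ℓ) ↔ Fin n) where

    point : Fin m → Fin ℓ → Fin n
    point i k = Inverse.to β (i , k)

    block : Matrix n → Fin m → Fin m → Matrix ℓ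
    block M i j k l = M (point i k) (point j l)

    factor : Relation n → Relation m
    factor c i j = ⌊ any? (λ k → any? λ l → T? (c (point i k) (point j l))) ⌋

    blockOf : Fin n → Fin m
    blockOf x = proj₁ (Inverse.from β x)

    positionOf : Fin n → Fin ℓ
    positionOf x = proj₂ (Inverse.from β x)

    point-blockOf-positionOf : ∀ x → point (blockOf x) (positionOf x) ≡ x
    point-blockOf-positionOf = Inverse.strictlyInverseˡ β

    blockOf-point : ∀ i k → blockOf (point i k) ≡ i
    blockOf-point i k = ≡.cong proj₁ (Inverse.strictlyInverseʳ β (i , k))

    positionOf-point : ∀ i k → positionOf (point i k) ≡ k
    positionOf-point i k = ≡.cong proj₂ (Inverse.strictlyInverseʳ β (i , k))

    ∀point⇒∀ : ∀ {p} (P : Fin n → Set p) → (∀ i k → P (point i k)) → ∀ x → P x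
    ∀point⇒∀ P P-points x = ≡.subst P (point-blockOf-positionOf x) (P-points (blockOf x) (positionOf x))

    ≋-byBlocks : ∀ {A B} → (∀ i j → block A i j ≋ block B i j) → A ≋ B
    ≋-byBlocks A≋B = ∀point⇒∀ _ λ i k → ∀point⇒∀ _ λ j l → A≋B i j k l

    factor-intro : ∀ {c : Relation n} {i k j l} → T (c (point i k) (point j l)) → T (factor c i j)
    factor-intro {k = k} {l = l} kl∈c = fromWitness (k , l , kl∈c)

    factor-elim : ∀ {c : Relation n} {i j} → T (factor c i j) →
                  ∃₂ λ k l → T (c (point i k) (point j l))
    factor-elim = toWitness

    factor-blockOf : ∀ {c : Relation n} {x y} → T (c x y) → T (factor c (blockOf x) (blockOf y))
    factor-blockOf {c} {x} {y} xy∈c = factor-intro {c}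
      (≡.subst₂ (λ x y → T (c x y)) (≡.sym (point-blockOf-positionOf x))
                (≡.sym (point-blockOf-positionOf y)) xy∈c)

    -- Reindexing along the bijection `β` is reduced to exchanging sums: the Kronecker delta
    -- `δ z i k` marks that `z` is `point i k`. Summed over `i` and `k` it gives 1, and summed over
    -- `z` against `f` it picks out one value.
    sum-blocks : ∀ (f : Fin n → Carrier) → sum f ≈ sum λ i → sum λ k → f (point i k)
    sum-blocks f = begin
      sum f
        ≈⟨ sum-cong-≋ (λ (z : Fin n) → sym (expand z)) ⟩
      sum (λ z → sum λ i → sum λ k → δ z i k * f z)
        ≈⟨ ∑-comm (λ z i → sum λ k → δ z i k * f z) ⟩
      sum (λ i → sum λ z → sum λ k → δ z i k * f z)
        ≈⟨ sum-cong-≋ (λ (i : Fin m) → ∑-comm (λ z k → δ z i k * f z)) ⟩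
      sum (λ i → sum λ k → sum λ z → δ z i k * f z)
        ≈⟨ sum-cong-≋ (λ (i : Fin m) → sum-cong-≋ λ (k : Fin ℓ) → collapse i k) ⟩
      sum (λ i → sum λ k → f (point i k)) ∎
      where
      δ : Fin n → Fin m → Fin ℓ → Carrier
      δ z i k = 𝟙 (point i k) z

      δ-off : ∀ {z i k} → point i k ≢ z → δ z i k * f z ≈ 0#
      δ-off {z} {i} {k} ≢z = *-zero-ˡ (f z) (bit-false {⌊ point i k ≟ z ⌋} (≢z ∘ toWitness))

      δ-on : ∀ {z i k} → point i k ≡ z → δ z i k * f z ≈ f z
      δ-on {z} {i} {k} ≡z =
        trans (*-congʳ (bit-true {⌊ point i k ≟ z ⌋} (fromWitness ≡z))) (*-identityˡ (f z))

      expand : ∀ z → sum (λ i → sum λ k → δ z i k * f z) ≈ f z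
      expand z = begin
        sum (λ i → sum λ k → δ z i k * f z)
          ≈⟨ sum-single (λ i → sum λ k → δ z i k * f z) (blockOf z) (λ i i≢ →
               sum-≈0 (λ k → δ z i k * f z) λ k → δ-off {z} {i} {k} λ ik≡z →
                 i≢ (≡.trans (≡.sym (blockOf-point i k)) (≡.cong blockOf ik≡z))) ⟩
        sum (λ k → δ z (blockOf z) k * f z)
          ≈⟨ sum-single (λ k → δ z (blockOf z) k * f z) (positionOf z) (λ k k≢ →
               δ-off {z} {blockOf z} {k} λ ik≡z →
                 k≢ (≡.trans (≡.sym (positionOf-point (blockOf z) k)) (≡.cong positionOf ik≡z))) ⟩
        δ z (blockOf z) (positionOf z) * f z
          ≈⟨ δ-on (point-blockOf-positionOf z) ⟩
        f z ∎

      collapse : ∀ i k → sum (λ z → δ z i k * f z) ≈ f (point i k)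
      collapse i k = trans
        (sum-single (λ z → δ z i k * f z) (point i k) (λ z z≢ → δ-off {z} {i} {k} (z≢ ∘ ≡.sym)))
        (δ-on {point i k} {i} {k} ≡.refl)

    infixl 8 _⊗_
    -- The Kronecker product, in the coordinates on X given by `β`.
    _⊗_ : Matrix m → Matrix ℓ → Matrix n
    (A ⊗ a) x y = A (blockOf x) (blockOf y) * a (positionOf x) (positionOf y)

    block-⊗ : ∀ A a i j → block (A ⊗ a) i j ≋ A i j ⊡ a
    block-⊗ A a i j k l
      rewrite blockOf-point i k | blockOf-point j l | positionOf-point i k | positionOf-point j l = refl

    ≋-⊗ : ∀ {M A a} → (∀ i j → block M i j ≋ A i j ⊡ a) → M ≋ A ⊗ a
    ≋-⊗ {M} {A} {a} M≋Aa = ≋-byBlocks λ i j k l →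
      trans (M≋Aa i j k l) (sym (block-⊗ A a i j k l))

    ⊗-cong : ∀ {A A′ a a′} → A ≋ A′ → a ≋ a′ → A ⊗ a ≋ A′ ⊗ a′
    ⊗-cong A≋A′ a≋a′ x y = *-cong (A≋A′ _ _) (a≋a′ _ _)

    -- The mixed-product rule: after `sum-blocks`, the double sum factors into one sum over blocks
    -- and one over positions.
    ⊗-⊠ : ∀ A B a b → (A ⊗ a) ⊠ (B ⊗ b) ≋ (A ⊠ B) ⊗ (a ⊠ b)
    ⊗-⊠ A B a b x y = begin
      sum (λ z → (A X (blockOf z) * a p (positionOf z)) * (B (blockOf z) Y * b (positionOf z) q))
        ≈⟨ sum-blocks (λ z →
             (A X (blockOf z) * a p (positionOf z)) * (B (blockOf z) Y * b (positionOf z) q)) ⟩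
      _
        ≈⟨ sum-cong-≋ (λ (i : Fin m) → sum-cong-≋ λ (k : Fin ℓ) → step i k) ⟩
      sum (λ i → sum λ k → (A X i * B i Y) * (a p k * b k q))
        ≈⟨ sum-cong-≋ (λ (i : Fin m) → *-distribˡ-sum (A X i * B i Y) (λ k → a p k * b k q)) ⟨
      sum (λ i → (A X i * B i Y) * (a ⊠ b) p q)
        ≈⟨ *-distribʳ-sum ((a ⊠ b) p q) (λ i → A X i * B i Y) ⟨
      (A ⊠ B) X Y * (a ⊠ b) p q ∎
      where
      X Y : Fin m
      X = blockOf x
      Y = blockOf y
      p q : Fin ℓ
      p = positionOf x
      q = positionOf y
      step : ∀ i k → (A X (blockOf (point i k)) * a p (positionOf (point i k))) *
                     (B (blockOf (point i k)) Y * b (positionOf (point i k)) q) ≈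
                     (A X i * B i Y) * (a p k * b k q)
      step i k rewrite blockOf-point i k | positionOf-point i k =
        interchange (A X i) (a p k) (B i Y) (b k q)

    IsBlockDiagonal : Pred (Matrix n) 0ℓ
    IsBlockDiagonal A = ∀ {x y} → blockOf x ≢ blockOf y → A x y ≈ 0#

    blockDiagonal-⊠ : ∀ {A B} → IsBlockDiagonal A → IsBlockDiagonal B → IsBlockDiagonal (A ⊠ B)
    blockDiagonal-⊠ {A} {B} diagA diagB {x} {y} X≢Y = sum-≈0 (λ z → A x z * B z y) term
      where
      term : ∀ z → A x z * B z y ≈ 0#
      term z with blockOf x ≟ blockOf z
      ... | no X≢Z = *-zero-ˡ (B z y) (diagA X≢Z)
      ... | yes X≡Z = *-zero-ʳ (A x z) (diagB (X≢Y ∘ ≡.trans X≡Z))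

    blockDiagonal-⊟ : ∀ {A B} → IsBlockDiagonal A → IsBlockDiagonal B → IsBlockDiagonal (A ⊟ B)
    blockDiagonal-⊟ diagA diagB X≢Y =
      trans (+-cong (diagA X≢Y) (-‿cong (diagB X≢Y))) (-‿inverseʳ 0#)

    blockDiagonal-† : ∀ {A} → IsBlockDiagonal A → IsBlockDiagonal (A †)
    blockDiagonal-† diagA X≢Y = trans (̄-cong (diagA (X≢Y ∘ ≡.sym))) ̄-0

    -- A block diagonal factor on the left does not mix block rows: only the intermediate points in
    -- block `i` contribute, and there `B` is zero. With its mirror image below, this keeps E A E
    -- within the blocks met by A.
    blockDiagonal-⊠-vanishes : ∀ {A B i j} → IsBlockDiagonal A → block B i j ≋ 𝟘 →
                               block (A ⊠ B) i j ≋ 𝟘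
    blockDiagonal-⊠-vanishes {A} {B} {i} {j} diagA B≋𝟘 k l =
      sum-≈0 (λ z → A (point i k) z * B z (point j l)) (∀point⇒∀ _ term)
      where
      term : ∀ i′ k′ → A (point i k) (point i′ k′) * B (point i′ k′) (point j l) ≈ 0#
      term i′ k′ with i ≟ i′
      ... | yes ≡.refl = *-zero-ʳ _ (B≋𝟘 k′ l)
      ... | no i≢i′ = *-zero-ˡ _ (diagA λ X≡Z →
        i≢i′ (≡.trans (≡.sym (blockOf-point i k)) (≡.trans X≡Z (blockOf-point i′ k′))))

    ⊠-blockDiagonal-vanishes : ∀ {A B i j} → IsBlockDiagonal A → block B i j ≋ 𝟘 →
                               block (B ⊠ A) i j ≋ 𝟘
    ⊠-blockDiagonal-vanishes {A} {B} {i} {j} diagA B≋𝟘 k l =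
      sum-≈0 (λ z → B (point i k) z * A z (point j l)) (∀point⇒∀ _ term)
      where
      term : ∀ j′ l′ → B (point i k) (point j′ l′) * A (point j′ l′) (point j l) ≈ 0#
      term j′ l′ with j ≟ j′
      ... | yes ≡.refl = *-zero-ˡ _ (B≋𝟘 k l′)
      ... | no j≢j′ = *-zero-ʳ _ (diagA λ Z≡Y →
        j≢j′ (≡.trans (≡.sym (blockOf-point j l)) (≡.trans (≡.sym Z≡Y) (blockOf-point j′ l′))))

  -- Closure properties of the adjacency algebra and transport of paths.

  module Configuration {n r} (C : Fin r → Relation n)
    (nonempty : ∀ c → ∃₂ λ x y → T (C c x y))
    (covering : ∀ x y → ∃ λ c → T (C c x y))
    (disjoint : ∀ {c d x y} → T (C c x y) → T (C d x y) → c ≡ d)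
    (transpose : ∀ c → ∃ λ d → C d ≐ flip (C c))
    (diagonal : ∃ λ c → C c ≐ (λ x y → ⌊ x ≟ y ⌋))
    (algebra : MultiplicativelyClosed (Span λ c → adj (C c))) where
    open Partition C nonempty covering disjoint public

    const-resp : ∀ {A B} → A ≋ B → ConstantOnClasses A → ConstantOnClasses B
    const-resp A≋B constA {c} {x} {y} {x′} {y′} p q =
      trans (sym (A≋B x y)) (trans (constA p q) (A≋B x′ y′))

    const-⊠ : ∀ {A B} → ConstantOnClasses A → ConstantOnClasses B → ConstantOnClasses (A ⊠ B)
    const-⊠ {A} {B} constA constB = Span⇒ConstantOnClasses
      (algebra A B (ConstantOnClasses⇒Span constA) (ConstantOnClasses⇒Span constB))

    const-⊟ : ∀ {A B} → ConstantOnClasses A → ConstantOnClasses B → ConstantOnClasses (A ⊟ B)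
    const-⊟ constA constB p q = +-cong (constA p q) (-‿cong (constB p q))

    const-⊡ : ∀ a {A} → ConstantOnClasses A → ConstantOnClasses (a ⊡ A)
    const-⊡ a constA p q = *-congˡ (constA p q)

    const-linComb : ∀ {k} (a : Fin k → Carrier) {F} → (∀ i → ConstantOnClasses (F i)) →
                    ConstantOnClasses (linComb a F)
    const-linComb {k} a constF p q = sum-cong-≋ λ (i : Fin k) → *-congˡ (constF i p q)

    const-† : ∀ {A} → ConstantOnClasses A → ConstantOnClasses (A †)
    const-† {A} constA {c} {x} {y} {x′} {y′} xy∈c x′y′∈c with transpose c
    ... | d , d≐c* = ̄-cong (constA (≡.subst T (≡.sym (d≐c* y x)) xy∈c)
                                   (≡.subst T (≡.sym (d≐c* y′ x′)) x′y′∈c))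

    const-adj : ∀ c → ConstantOnClasses (adj (C c))
    const-adj c {d} {x} {y} {x′} {y′} xy∈d x′y′∈d =
      reflexive (≡.cong bit (T⇔T⇒≡
        (λ xy∈c → ≡.subst (λ e → T (C e x′ y′)) (disjoint xy∈d xy∈c) x′y′∈d)
        (λ x′y′∈c → ≡.subst (λ e → T (C e x y)) (disjoint x′y′∈d x′y′∈c) xy∈d)))

    -- The entry of A_c A_d at a pair counts the paths between its ends and is the same throughout
    -- `e`. If there were no path from `x′` to `y′`, the count would be zero at `(x , y)` too,
    -- against the path through `z`.
    path-transport : ∀ {c d e x y z x′ y′} → T (C c x z) → T (C d z y) →
      T (C e x y) → T (C e x′ y′) → ∃ λ z′ → T (C c x′ z′) × T (C d z′ y′)
    path-transport {c} {d} {e} {x} {y} {z} {x′} {y′} xz∈c zy∈d xy∈e x′y′∈e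
      with any? (λ z′ → T? (C c x′ z′) ×-dec T? (C d z′ y′))
    ... | yes path = path
    ... | no ¬path = contradiction
      (sum-bits≈0 (λ w → C c x w) (λ w → C d w y)
        (trans (const-⊠ (const-adj c) (const-adj d) xy∈e x′y′∈e) no-paths) z)
      (bit*bit≉0 xz∈c zy∈d)
      where
      no-paths : (adj (C c) ⊠ adj (C d)) x′ y′ ≈ 0#
      no-paths = sum-≈0 _ λ w → term w
        where
        term : ∀ w → bit (C c x′ w) * bit (C d w y′) ≈ 0#
        term w with T? (C c x′ w) | T? (C d w y′)
        ... | no ∉c | _ = *-zero-ˡ _ (bit-false ∉c)
        ... | yes _ | no ∉d = *-zero-ʳ _ (bit-false ∉d)
        ... | yes ∈c | yes ∈d = contradiction (w , ∈c , ∈d) ¬path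

    -- The blocks of a closed subset and the classes that meet them.

    module Factor {m ℓ} (β : (Fin m × Fin ℓ) ↔ Fin n) (D : Subset r)
      (cosets : ∀ i k j l →
        (∃ λ d → d ∈ D × T (C d (Inverse.to β (i , k)) (Inverse.to β (j , l)))) ⇔ (i ≡ j))
      where
      open Blocks β public

      sameBlock : ∀ {x y} → blockOf x ≡ blockOf y ⇔ (∃ λ d → d ∈ D × T (C d x y))
      sameBlock {x} {y} = ≡.subst₂
        (λ x′ y′ → blockOf x ≡ blockOf y ⇔ (∃ λ d → d ∈ D × T (C d x′ y′)))
        (point-blockOf-positionOf x) (point-blockOf-positionOf y)
        (⇔.sym (cosets (blockOf x) (positionOf x) (blockOf y) (positionOf y)))

      -- The algebra ℂD as the block diagonal part of ℂC. The two agree because the blocks are the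
      -- sets xD: a class containing a pair within one block lies in D, and the classes of D join
      -- only points of one block. Closure under products, differences and adjoints is immediate in
      -- this form.
      InD : Pred (Matrix n) 0ℓ
      InD M = ConstantOnClasses M × IsBlockDiagonal M

      SpanOn⇒InD : ∀ {M} → SpanOn D (λ c → adj (C c)) M → InD M
      SpanOn⇒InD {M} (a , a-off , M≋a) = Span⇒ConstantOnClasses (a , M≋a) , diagonalM
        where
        diagonalM : IsBlockDiagonal M
        diagonalM {x} {y} X≢Y with covering x y
        ... | c , xy∈c = trans (M≋a x y) (trans (linComb-adj a xy∈c)
          (a-off c λ c∈D → X≢Y (Equivalence.from sameBlock (c , c∈D , xy∈c))))

      InD⇒SpanOn : ∀ {M} → InD M → SpanOn D (λ c → adj (C c)) M
      InD⇒SpanOn {M} (constM , diagM) = valueOn M , off , ConstantOnClasses⇒linComb constM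
        where
        off : ∀ c → c ∉ D → valueOn M c ≈ 0#
        off c c∉D with nonempty c
        ... | x , y , xy∈c = diagM λ X≡Y →
          let d , d∈D , xy∈d = Equivalence.to sameBlock X≡Y
          in c∉D (≡.subst (_∈ D) (disjoint xy∈d xy∈c) d∈D)

      InD-⊠ : ∀ {A B} → InD A → InD B → InD (A ⊠ B)
      InD-⊠ (constA , diagA) (constB , diagB) = const-⊠ constA constB , blockDiagonal-⊠ diagA diagB

      InD-⊟ : ∀ {A B} → InD A → InD B → InD (A ⊟ B)
      InD-⊟ (constA , diagA) (constB , diagB) = const-⊟ constA constB , blockDiagonal-⊟ diagA diagB

      InD-† : ∀ {A} → InD A → InD (A †)
      InD-† (constA , diagA) = const-† constA , blockDiagonal-† diagA

      -- Inside the common block, a pair of `c` is joined to a pair of `c′` by steps in D at either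
      -- end. The resulting path d₁, c′, d₂ is carried along `c` to the other block; the steps in D
      -- stay within blocks, so the middle step is a pair of `c′` there.
      factor-meet : ∀ c c′ {i j i′ j′} → T (factor (C c) i j) → T (factor (C c′) i j) →
                    T (factor (C c) i′ j′) → T (factor (C c′) i′ j′)
      factor-meet c c′ {i} {j} {i′} {j′} ij∈c ij∈c′ i′j′∈c
        with factor-elim {C c} ij∈c | factor-elim {C c′} ij∈c′ | factor-elim {C c} i′j′∈c
      ... | k , l , kl∈c | k₁ , l₁ , k₁l₁∈c′ | k′ , l′ , k′l′∈c
        -- The path runs from `k` to `k₁` in d₁, on to `l₁` in `c′`, and on to `l` in d₂. The class
        -- `c″` of the shortcut from `k₁` to `l` breaks it into two paths of length two, each of
        -- which can be transported.
        with Equivalence.from (cosets i k i k₁) ≡.refl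
           | Equivalence.from (cosets j l₁ j l) ≡.refl
           | covering (point i k₁) (point j l)
      ... | d₁ , d₁∈D , kk₁∈d₁ | d₂ , d₂∈D , l₁l∈d₂ | c″ , k₁l∈c″
        with path-transport kk₁∈d₁ k₁l∈c″ kl∈c k′l′∈c
      ... | x , k′x∈d₁ , xl′∈c″
        with path-transport k₁l₁∈c′ l₁l∈d₂ k₁l∈c″ xl′∈c″
      ... | y , xy∈c′ , yl′∈d₂ =
        ≡.subst₂ (λ i j → T (factor (C c′) i j)) X≡i′ Y≡j′ (factor-blockOf {C c′} xy∈c′)
        where
        X≡i′ : blockOf x ≡ i′
        X≡i′ = ≡.trans (≡.sym (Equivalence.from sameBlock (d₁ , d₁∈D , k′x∈d₁))) (blockOf-point i′ k′)
        Y≡j′ : blockOf y ≡ j′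
        Y≡j′ = ≡.trans (Equivalence.from sameBlock (d₂ , d₂∈D , yl′∈d₂)) (blockOf-point j′ l′)

      factor-≐ : ∀ c c′ {i j} → T (factor (C c) i j) → T (factor (C c′) i j) →
                 factor (C c) ≐ factor (C c′)
      factor-≐ c c′ ij∈c ij∈c′ i′ j′ =
        T⇔T⇒≡ (factor-meet c c′ ij∈c ij∈c′) (factor-meet c′ c ij∈c′ ij∈c)

      -- By `factor-meet`, the class of any entry of the new block also has an entry in the old one.
      -- Comparing two matrices covers both applications: `Q` zero for vanishing, and `Q` a multiple
      -- of some E A_c E for proportionality.
      block-transport : ∀ {P Q} → ConstantOnClasses P → ConstantOnClasses Q →
        ∀ c {i j i′ j′} → T (factor (C c) i j) → T (factor (C c) i′ j′) →
        block P i j ≋ block Q i j → block P i′ j′ ≋ block Q i′ j′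
      block-transport constP constQ c {i} {j} {i′} {j′} ij∈c i′j′∈c P≋Q k l
        with covering (point i′ k) (point j′ l)
      ... | c′ , kl∈c′
        with factor-elim {C c′} (factor-meet c c′ i′j′∈c (factor-intro {C c′} kl∈c′) ij∈c)
      ... | k₀ , l₀ , k₀l₀∈c′ =
        trans (constP kl∈c′ k₀l₀∈c′) (trans (P≋Q k₀ l₀) (constQ k₀l₀∈c′ kl∈c′))

      -- The factor configuration.

      module Representatives {q} (rep : Fin q → Fin r)
        (complete : ∀ c → ∃ λ s → factor (C c) ≐ factor (C (rep s)))
        (irredundant : ∀ s t → factor (C (rep s)) ≐ factor (C (rep t)) → s ≡ t) where

        F : Fin q → Relation m
        F s = factor (C (rep s))

        -- Shows that blocks are non-empty: the diagonal class contains a pair, and the position of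
        -- its first point exists in every block.
        somePosition : Fin ℓ
        somePosition = positionOf (proj₁ (nonempty (proj₁ diagonal)))

        complete-T : ∀ c → ∃ λ s → ∀ {i j} → T (factor (C c) i j) → T (F s i j)
        complete-T c with complete c
        ... | s , c≐s = s , λ {i} {j} → ≡.subst T (c≐s i j)

        F-nonempty : ∀ s → ∃₂ λ i j → T (F s i j)
        F-nonempty s with nonempty (rep s)
        ... | x , y , xy∈s = blockOf x , blockOf y , factor-blockOf {C (rep s)} xy∈s

        F-covering : ∀ i j → ∃ λ s → T (F s i j)
        F-covering i j with covering (point i somePosition) (point j somePosition)
        ... | c , kl∈c with complete-T c
        ...   | s , c⇒s = s , c⇒s (factor-intro {C c} kl∈c)

        F-disjoint : ∀ {s t i j} → T (F s i j) → T (F t i j) → s ≡ t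
        F-disjoint {s} {t} ij∈s ij∈t = irredundant s t (factor-≐ (rep s) (rep t) ij∈s ij∈t)

        factor-flip : ∀ {c d} → C d ≐ flip (C c) → ∀ {i j} → T (factor (C c) i j) → T (factor (C d) j i)
        factor-flip {c} {d} d≐c* {i} {j} ij∈c with factor-elim {C c} ij∈c
        ... | k , l , kl∈c = factor-intro {C d} (≡.subst T (≡.sym (d≐c* (point j l) (point i k))) kl∈c)

        -- The converse `d` of a representative need not be a representative, so `complete` replaces
        -- it by one with the same image.
        F-transpose : ∀ s → ∃ λ t → F t ≐ flip (F s)
        F-transpose s with transpose (rep s)
        ... | d , d≐s* with complete d
        ...   | t , d≐t = t , λ i j → ≡.trans (≡.sym (d≐t i j)) (T⇔T⇒≡ flip⁻ (factor-flip d≐s*))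
          where
          flip⁻ : ∀ {i j} → T (factor (C d) i j) → T (F s j i)
          flip⁻ = factor-flip λ x y → ≡.sym (d≐s* y x)

        factor-diagonal : ∀ i j → factor (C (proj₁ diagonal)) i j ≡ ⌊ i ≟ j ⌋
        factor-diagonal i j = T⇔T⇒≡ to from
          where
          d : Fin r
          d = proj₁ diagonal
          to : T (factor (C d) i j) → T ⌊ i ≟ j ⌋
          to ij∈d with factor-elim {C d} ij∈d
          ... | k , l , kl∈d = fromWitness (≡.trans (≡.sym (blockOf-point i k)) (≡.trans
            (≡.cong blockOf (toWitness (≡.subst T (proj₂ diagonal (point i k) (point j l)) kl∈d)))
            (blockOf-point j l)))
          from : T ⌊ i ≟ j ⌋ → T (factor (C d) i j)
          from i≡j = factor-intro {C d} {k = somePosition} {l = somePosition}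
            (≡.subst T (≡.sym (proj₂ diagonal _ _))
              (fromWitness (≡.cong (λ i → point i somePosition) (toWitness i≡j))))

        F-diagonal : ∃ λ s → F s ≐ (λ i j → ⌊ i ≟ j ⌋)
        F-diagonal with complete (proj₁ diagonal)
        ... | s , d≐s = s , λ i j → ≡.trans (≡.sym (d≐s i j)) (factor-diagonal i j)

        module P/D = Partition F F-nonempty F-covering F-disjoint

        -- The all-ones block: `A ⊗ 𝟏` inflates a matrix on X/D to one on X that is constant on each
        -- block.
        𝟏 : Matrix ℓ
        𝟏 _ _ = 1#

        -- The entry is the block size ℓ in the field. It is a sum of norms of 1, and the index `k`
        -- guarantees at least one summand.
        𝟏⊠𝟏≉0 : ∀ k l → ¬ ((𝟏 ⊠ 𝟏) k l ≈ 0#)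
        𝟏⊠𝟏≉0 k l s≈0 = 1≉0 (anisotropic (λ (_ : Fin ℓ) → 1#)
          (trans (sum-cong-≋ λ (_ : Fin ℓ) → *-congˡ ̄-1) s≈0) k)

        ⊗𝟏-const : ∀ {A} → P/D.ConstantOnClasses A → ConstantOnClasses (A ⊗ 𝟏)
        ⊗𝟏-const constA {c} xy∈c x′y′∈c with complete-T c
        ... | s , c⇒s =
          *-congʳ (constA (c⇒s (factor-blockOf {C c} xy∈c)) (c⇒s (factor-blockOf {C c} x′y′∈c)))

        F-algebra : MultiplicativelyClosed (Span λ s → adj (F s))
        F-algebra A B A∈ B∈ = P/D.ConstantOnClasses⇒Span constAB
          where
          constAB⊗ : ConstantOnClasses ((A ⊠ B) ⊗ (𝟏 ⊠ 𝟏))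
          constAB⊗ = const-resp (⊗-⊠ A B 𝟏 𝟏)
            (const-⊠ (⊗𝟏-const (P/D.Span⇒ConstantOnClasses A∈))
                     (⊗𝟏-const (P/D.Span⇒ConstantOnClasses B∈)))
          constAB : P/D.ConstantOnClasses (A ⊠ B)
          constAB {s} {i} {j} {i′} {j′} ij∈s i′j′∈s
            with factor-elim {C (rep s)} ij∈s | factor-elim {C (rep s)} i′j′∈s
          -- The factor cancelled at the two ends is the same: `(𝟏 ⊠ 𝟏) k l` does not depend on `k`
          -- and `l`, even definitionally.
          ... | k , l , kl∈s | k′ , l′ , k′l′∈s = *-cancelʳ (𝟏⊠𝟏≉0 k l) (begin
            (A ⊠ B) i j * (𝟏 ⊠ 𝟏) k l
              ≈⟨ block-⊗ (A ⊠ B) (𝟏 ⊠ 𝟏) i j k l ⟨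
            ((A ⊠ B) ⊗ (𝟏 ⊠ 𝟏)) (point i k) (point j l)
              ≈⟨ constAB⊗ kl∈s k′l′∈s ⟩
            ((A ⊠ B) ⊗ (𝟏 ⊠ 𝟏)) (point i′ k′) (point j′ l′)
              ≈⟨ block-⊗ (A ⊠ B) (𝟏 ⊠ 𝟏) i′ j′ k′ l′ ⟩
            (A ⊠ B) i′ j′ * (𝟏 ⊠ 𝟏) k′ l′ ∎)

        -- The weight and its axioms.

        -- G c plays the role of Γ (E A_c E).
        module Weight
          (E : Matrix n) (E∈ : InD E) (E-idempotent : E ⊠ E ≋ E)
          (E-hermitian : E † ≋ E) (E≉𝟘 : ¬ (E ≋ 𝟘))
          (e : Matrix ℓ) (E-blocks : ∀ i → block E i i ≋ e)
          (G : Fin r → Matrix m) (G-blocks : ∀ c i j → block (E ⊠ adj (C c) ⊠ E) i j ≋ G c i j ⊡ e)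
          (nonvanishing : ∀ s c → factor (C c) ≐ F s →
                          ¬ (E ⊠ adj (C c) ⊠ E ≋ 𝟘) → ¬ (E ⊠ adj (C (rep s)) ⊠ E ≋ 𝟘)) where

          E-diagonal : IsBlockDiagonal E
          E-diagonal = proj₂ E∈

          M : Fin r → Matrix n
          M c = E ⊠ adj (C c) ⊠ E

          W : Matrix m
          W i j = sum λ s → G (rep s) i j

          M-const : ∀ c → ConstantOnClasses (M c)
          M-const c = const-⊠ (const-⊠ (proj₁ E∈) (const-adj c)) (proj₁ E∈)

          sandwich-vanishes : ∀ {A i j} → block A i j ≋ 𝟘 → block (E ⊠ A ⊠ E) i j ≋ 𝟘
          sandwich-vanishes {A} {i} {j} A≋𝟘 =
            ⊠-blockDiagonal-vanishes {E} {E ⊠ A} {i} {j} E-diagonal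
              (blockDiagonal-⊠-vanishes {E} {A} {i} {j} E-diagonal A≋𝟘)

          M-off : ∀ c {i j} → ¬ T (factor (C c) i j) → block (M c) i j ≋ 𝟘
          M-off c {i} {j} ij∉c = sandwich-vanishes {adj (C c)} {i} {j} λ k l →
            bit-false {C c (point i k) (point j l)} λ kl∈c → ij∉c (factor-intro {C c} kl∈c)

          -- Equal diagonal blocks make E a Kronecker product with the identity on X/D.
          -- Multiplication by E therefore acts on the second factor only and fixes every `A ⊗ e`.
          E≋𝟙⊗e : E ≋ 𝟙 ⊗ e
          E≋𝟙⊗e = ≋-⊗ blocks
            where
            blocks : ∀ i j → block E i j ≋ 𝟙 i j ⊡ e
            blocks i j k l with i ≟ j
            ... | yes ≡.refl = trans (E-blocks i k l) (sym (*-identityˡ (e k l)))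
            ... | no i≢j = trans
              (E-diagonal λ X≡Y →
                i≢j (≡.trans (≡.sym (blockOf-point i k)) (≡.trans X≡Y (blockOf-point j l))))
              (sym (zeroˡ (e k l)))

          e-nonzeroEntry : ∃₂ λ k l → ¬ (e k l ≈ 0#)
          e-nonzeroEntry = ≋𝟘-nonzeroEntry e λ e≋𝟘 → E≉𝟘 λ x y →
            trans (E≋𝟙⊗e x y) (*-zero-ʳ (𝟙 (blockOf x) (blockOf y)) (e≋𝟘 (positionOf x) (positionOf y)))

          -- Passes from blocks to their coefficients; `e` has a non-zero entry because E is not
          -- zero.
          ⊡e-cancel : ∀ {a b} → a ⊡ e ≋ b ⊡ e → a ≈ b
          ⊡e-cancel ae≋be with e-nonzeroEntry
          ... | k , l , ekl≉0 = *-cancelʳ ekl≉0 (ae≋be k l)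

          ⊡e≋𝟘⇒≈0 : ∀ {a} → a ⊡ e ≋ 𝟘 → a ≈ 0#
          ⊡e≋𝟘⇒≈0 ae≋𝟘 = ⊡e-cancel λ k l → trans (ae≋𝟘 k l) (sym (zeroˡ (e k l)))

          ≈0⇒⊡e≋𝟘 : ∀ {a} → a ≈ 0# → a ⊡ e ≋ 𝟘
          ≈0⇒⊡e≋𝟘 a≈0 k l = *-zero-ˡ (e k l) a≈0

          e-idempotent : e ⊠ e ≋ e
          e-idempotent k l = begin
            (e ⊠ e) k l                                      ≈⟨ *-identityˡ ((e ⊠ e) k l) ⟨
            1# * (e ⊠ e) k l                                 ≈⟨ *-congʳ (trans (𝟙⊠A≋A 𝟙 i i) 𝟙ii≈1) ⟨
            (𝟙 ⊠ 𝟙) i i * (e ⊠ e) k l                        ≈⟨ block-⊗ (𝟙 ⊠ 𝟙) (e ⊠ e) i i k l ⟨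
            ((𝟙 ⊠ 𝟙) ⊗ (e ⊠ e)) (point i k) (point i l)      ≈⟨ ⊗-⊠ 𝟙 𝟙 e e (point i k) (point i l) ⟨
            ((𝟙 ⊗ e) ⊠ (𝟙 ⊗ e)) (point i k) (point i l)      ≈⟨ ⊠-cong E≋𝟙⊗e E≋𝟙⊗e (point i k) (point i l) ⟨
            (E ⊠ E) (point i k) (point i l)                  ≈⟨ E-idempotent (point i k) (point i l) ⟩
            E (point i k) (point i l)                        ≈⟨ E-blocks i k l ⟩
            e k l                                            ∎
            where
            i : Fin m
            -- The block whose diagonal part is compared must exist; the non-empty diagonal class
            -- supplies a point of it.
            i = blockOf (proj₁ (nonempty (proj₁ diagonal)))
            𝟙ii≈1 : 𝟙 i i ≈ 1#
            𝟙ii≈1 = bit-true {⌊ i ≟ i ⌋} (fromWitness ≡.refl)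

          E⊠⊗e : ∀ A → E ⊠ (A ⊗ e) ≋ A ⊗ e
          E⊠⊗e A = ≋.trans (⊠-congʳ E≋𝟙⊗e) (≋.trans (⊗-⊠ 𝟙 A e e) (⊗-cong (𝟙⊠A≋A A) e-idempotent))

          ⊗e⊠E : ∀ A → (A ⊗ e) ⊠ E ≋ A ⊗ e
          ⊗e⊠E A = ≋.trans (⊠-congˡ {A = A ⊗ e} E≋𝟙⊗e)
            (≋.trans (⊗-⊠ A 𝟙 e e) (⊗-cong (A⊠𝟙≋A A) e-idempotent))

          ⊗e-⊠ : ∀ A B → (A ⊗ e) ⊠ (B ⊗ e) ≋ (A ⊠ B) ⊗ e
          ⊗e-⊠ A B = ≋.trans (⊗-⊠ A B e e) (⊗-cong {A ⊠ B} ≋.refl e-idempotent)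

          G-off : ∀ c {i j} → ¬ T (factor (C c) i j) → G c i j ≈ 0#
          G-off c {i} {j} ij∉c = ⊡e≋𝟘⇒≈0 λ k l →
            trans (sym (G-blocks c i j k l)) (M-off c ij∉c k l)

          -- Distinct representatives have disjoint images, so the other summands of `W` vanish at
          -- this entry.
          W-on : ∀ {s i j} → T (F s i j) → W i j ≈ G (rep s) i j
          W-on {s} {i} {j} ij∈s = sum-single (λ t → G (rep t) i j) s λ t t≢s →
            G-off (rep t) λ ij∈t → t≢s (F-disjoint ij∈t ij∈s)

          M-blocks : ∀ {s i j} → T (F s i j) → block (M (rep s)) i j ≋ W i j ⊡ e
          M-blocks {s} {i} {j} ij∈s k l = trans (G-blocks (rep s) i j k l) (*-congʳ (sym (W-on ij∈s)))

          W≈0⇒M≋𝟘 : ∀ {s i j} → T (F s i j) → W i j ≈ 0# → M (rep s) ≋ 𝟘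
          W≈0⇒M≋𝟘 {s} {i} {j} ij∈s Wij≈0 = ≋-byBlocks blocks
            where
            blocks : ∀ i′ j′ → block (M (rep s)) i′ j′ ≋ 𝟘
            blocks i′ j′ with T? (F s i′ j′)
            ... | no i′j′∉s = M-off (rep s) i′j′∉s
            ... | yes i′j′∈s = block-transport (M-const (rep s)) (λ _ _ → refl) (rep s) ij∈s i′j′∈s
              (λ k l → trans (M-blocks ij∈s k l) (≈0⇒⊡e≋𝟘 Wij≈0 k l))

          M≋𝟘⇒W≈0 : ∀ {s i j} → T (F s i j) → M (rep s) ≋ 𝟘 → W i j ≈ 0#
          M≋𝟘⇒W≈0 ij∈s M≋𝟘 = ⊡e≋𝟘⇒≈0 λ k l → trans (sym (M-blocks ij∈s k l)) (M≋𝟘 _ _)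

          -- The choice of representatives enters here: `c` is an arbitrary class, and
          -- `nonvanishing` hands its non-zero E A_c E over to the representative with the same
          -- image.
          M≉𝟘⇒W≉0 : ∀ {c i j} → T (factor (C c) i j) → ¬ (M c ≋ 𝟘) → ¬ (W i j ≈ 0#)
          M≉𝟘⇒W≉0 {c} ij∈c M≉𝟘 Wij≈0 with complete c
          ... | s , c≐s = nonvanishing s c c≐s M≉𝟘 (W≈0⇒M≋𝟘 (≐-transport c≐s ij∈c) Wij≈0)

          supportSet : Subset q
          supportSet = tabulate λ s → ⌊ ¬? (M (rep s) ≋𝟘?) ⌋

          ∈supportSet : ∀ {s} → s ∈ supportSet ⇔ (¬ (M (rep s) ≋ 𝟘))
          ∈supportSet {s} = mk⇔
            (λ s∈ → toWitness (Equivalence.from T-≡ (≡.trans (≡.sym lookup≡) ([]=⇒lookup s∈))))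
            (λ M≉𝟘 → lookup⇒[]= s supportSet (≡.trans lookup≡ (Equivalence.to T-≡ (fromWitness M≉𝟘))))
            where lookup≡ = lookup∘tabulate (λ s → ⌊ ¬? (M (rep s) ≋𝟘?) ⌋) s

          W-support : ∀ i j → (¬ (W i j ≈ 0#)) ⇔ (∃ λ s → s ∈ supportSet × T (F s i j))
          W-support i j = mk⇔ to from
            where
            to : ¬ (W i j ≈ 0#) → ∃ λ s → s ∈ supportSet × T (F s i j)
            to Wij≉0 with F-covering i j
            ... | s , ij∈s = s , Equivalence.from ∈supportSet (Wij≉0 ∘ M≋𝟘⇒W≈0 ij∈s) , ij∈s
            from : (∃ λ s → s ∈ supportSet × T (F s i j)) → ¬ (W i j ≈ 0#)
            from (s , s∈ , ij∈s) = Equivalence.to ∈supportSet s∈ ∘ W≈0⇒M≋𝟘 ij∈s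

          adj-† : ∀ {c d} → C d ≐ flip (C c) → adj (C c) † ≋ adj (C d)
          adj-† {c} {d} d≐c* x y rewrite d≐c* x y = bit-real (C c y x)
            where
            bit-real : ∀ b → bit b ̄ ≈ bit b
            bit-real true = ̄-1
            bit-real false = ̄-0

          M-† : ∀ {c d} → C d ≐ flip (C c) → M c † ≋ M d
          M-† {c} {d} d≐c* = R.begin
            (E ⊠ adj (C c) ⊠ E) †      R.≈⟨ †-⊠ (E ⊠ adj (C c)) E ⟩
            E † ⊠ (E ⊠ adj (C c)) †    R.≈⟨ ⊠-cong E-hermitian (†-⊠ E (adj (C c))) ⟩
            E ⊠ (adj (C c) † ⊠ E †)    R.≈⟨ ⊠-congˡ {A = E} (⊠-cong (adj-† d≐c*) E-hermitian) ⟩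
            E ⊠ (adj (C d) ⊠ E)        R.≈⟨ ⊠-assoc E (adj (C d)) E ⟨
            E ⊠ adj (C d) ⊠ E          R.∎
            where module R = SetoidReasoning (≋-setoid n)

          -- If `M d` were zero for the converse `d` of the representative at `(i , j)`, its adjoint
          -- `M (rep s)` would be zero too. As `d` itself may not be a representative, `M≉𝟘⇒W≉0` is
          -- needed for arbitrary classes.
          W-support-transpose : ∀ {i j} → ¬ (W i j ≈ 0#) → ¬ (W j i ≈ 0#)
          W-support-transpose {i} {j} Wij≉0 with F-covering i j
          ... | s , ij∈s with transpose (rep s)
          ...   | d , d≐s* = M≉𝟘⇒W≉0 {d} (factor-flip d≐s* ij∈s) λ Md≋𝟘 →
            Wij≉0 (M≋𝟘⇒W≈0 ij∈s λ x y → trans (sym (̄-involutive (M (rep s) x y)))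
              (trans (̄-cong (trans (M-† d≐s* y x) (Md≋𝟘 y x))) ̄-0))

          adj-diagonal : adj (C (proj₁ diagonal)) ≋ 𝟙
          adj-diagonal x y = reflexive (≡.cong bit (proj₂ diagonal x y))

          -- For the diagonal class, E A_c E is E² = E, which is not zero.
          W-diagonal : ∀ i → ¬ (W i i ≈ 0#)
          W-diagonal i = M≉𝟘⇒W≉0 {proj₁ diagonal}
            (≡.subst T (≡.sym (factor-diagonal i i)) (fromWitness ≡.refl))
            λ M≋𝟘 → E≉𝟘 (≋.trans (≋.sym M≋E) M≋𝟘)
            where
            M≋E : M (proj₁ diagonal) ≋ E
            M≋E = ≋.trans (⊠-congʳ (≋.trans (⊠-congˡ {A = E} adj-diagonal) (A⊠𝟙≋A E))) E-idempotent

          -- The same coefficients work upstairs: `A ⊗ e` is the combination of the matrices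
          -- `M (rep s)`, since only one of them is non-zero on the blocks of a given factor class.
          lift : ∀ {A} → Span (λ s → adj (F s) ∘ᴴ W) A → ConstantOnClasses (A ⊗ e)
          lift {A} (a , A≋a) = const-resp (≋-⊗ blocks) (const-linComb a (λ s → M-const (rep s)))
            where
            blocks : ∀ i j → block (linComb a (λ s → M (rep s))) i j ≋ A i j ⊡ e
            blocks i j k l with F-covering i j
            ... | s , ij∈s = begin
              sum (λ t → a t * M (rep t) (point i k) (point j l))
                ≈⟨ sum-single (λ t → a t * M (rep t) (point i k) (point j l)) s (λ t t≢s →
                     *-zero-ʳ (a t) (M-off (rep t) (λ ij∈t → t≢s (F-disjoint ij∈t ij∈s)) k l)) ⟩
              a s * M (rep s) (point i k) (point j l)
                ≈⟨ *-congˡ (M-blocks ij∈s k l) ⟩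
              a s * (W i j * e k l)
                ≈⟨ *-assoc (a s) (W i j) (e k l) ⟨
              (a s * W i j) * e k l
                ≈⟨ *-congʳ (trans (A≋a i j) (P/D.linComb-weighted W a ij∈s)) ⟨
              A i j * e k l ∎

          -- If E A_c E = 0 for all c in a factor class, then E P E vanishes on that class for
          -- every P in the adjacency algebra, and P = N ⊗ e is such a matrix with E P E = P.
          vanishesWithW : ∀ {N} → ConstantOnClasses (N ⊗ e) → ∀ {i j} → W i j ≈ 0# → N i j ≈ 0#
          vanishesWithW {N} constP {i} {j} Wij≈0 = ⊡e≋𝟘⇒≈0 λ k l →
            trans (sym (block-⊗ N e i j k l)) (trans (P≋EPE (point i k) (point j l)) (EPE≋𝟘 k l))
            where
            P : Matrix n
            P = N ⊗ e
            a : Fin r → Carrier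
            a = valueOn P
            P≋EPE : P ≋ linComb a M
            P≋EPE = ≋.trans (≋.sym (⊗e⊠E N)) (≋.trans (⊠-congʳ (≋.sym (E⊠⊗e N)))
              (≋.trans (⊠-congʳ (⊠-congˡ {A = E} (ConstantOnClasses⇒linComb constP)))
              (≋.trans (⊠-congʳ (⊠-linComb E a (λ c → adj (C c))))
                (linComb-⊠ E a (λ c → E ⊠ adj (C c))))))
            M≋𝟘 : ∀ c → block (M c) i j ≋ 𝟘
            M≋𝟘 c with T? (factor (C c) i j)
            ... | no ij∉c = M-off c ij∉c
            ... | yes ij∈c = λ k l →
              decidable-stable (M c ≋𝟘?) (λ Mc≉𝟘 → M≉𝟘⇒W≉0 {c} ij∈c Mc≉𝟘 Wij≈0) (point i k) (point j l)
            EPE≋𝟘 : block (linComb a M) i j ≋ 𝟘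
            EPE≋𝟘 k l = sum-≈0 (λ c → a c * M c (point i k) (point j l)) λ c → *-zero-ʳ (a c) (M≋𝟘 c k l)

          -- On each factor class the coefficient is read off at one block. When `W` is non-zero
          -- there, it is the quotient of `N` by `W`, and `block-transport` spreads the
          -- proportionality over the class.
          lower : ∀ {N} → ConstantOnClasses (N ⊗ e) → Span (λ s → adj (F s) ∘ᴴ W) N
          lower {N} constP = P/D.multipleOnClasses⇒Span W (proj₁ ∘ ratio) (λ {s} → proj₂ (ratio s))
            where
            ratio : ∀ s → ∃ λ t → ∀ {i j} → T (F s i j) → N i j ≈ t * W i j
            ratio s with F-nonempty s
            ... | i₀ , j₀ , i₀j₀∈s with W i₀ j₀ ≈? 0#
            -- Vanishing of `W` at one block spreads over the class through `M (rep s)`, and `N`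
            -- vanishes with it. Any coefficient would then do; 0 is taken.
            ...   | yes W₀≈0 = 0# , λ {i} {j} ij∈s →
              trans (vanishesWithW constP (M≋𝟘⇒W≈0 ij∈s (W≈0⇒M≋𝟘 i₀j₀∈s W₀≈0))) (sym (zeroˡ (W i j)))
            ...   | no W₀≉0 with inverse (W i₀ j₀) W₀≉0
            ...     | w , W₀w≈1 = t , on-class
              where
              t : Carrier
              t = N i₀ j₀ * w
              N₀≈tW₀ : N i₀ j₀ ≈ t * W i₀ j₀
              N₀≈tW₀ = sym (begin
                (N i₀ j₀ * w) * W i₀ j₀  ≈⟨ *-assoc (N i₀ j₀) w (W i₀ j₀) ⟩
                N i₀ j₀ * (w * W i₀ j₀)  ≈⟨ *-congˡ (trans (*-comm w (W i₀ j₀)) W₀w≈1) ⟩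
                N i₀ j₀ * 1#             ≈⟨ *-identityʳ (N i₀ j₀) ⟩
                N i₀ j₀                  ∎)
              tM-blocks : ∀ {i j} → T (F s i j) → block (t ⊡ M (rep s)) i j ≋ (t * W i j) ⊡ e
              tM-blocks {i} {j} ij∈s k l =
                trans (*-congˡ (M-blocks ij∈s k l)) (sym (*-assoc t (W i j) (e k l)))
              on-class : ∀ {i j} → T (F s i j) → N i j ≈ t * W i j
              on-class {i} {j} ij∈s = ⊡e-cancel λ k l → begin
                N i j * e k l
                  ≈⟨ block-⊗ N e i j k l ⟨
                (N ⊗ e) (point i k) (point j l)
                  ≈⟨ block-transport constP (const-⊡ t (M-const (rep s))) (rep s) i₀j₀∈s ij∈s base k l ⟩
                (t ⊡ M (rep s)) (point i k) (point j l)
                  ≈⟨ tM-blocks ij∈s k l ⟩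
                (t * W i j) * e k l ∎
                where
                base : block (N ⊗ e) i₀ j₀ ≋ block (t ⊡ M (rep s)) i₀ j₀
                base k l = trans (block-⊗ N e i₀ j₀ k l)
                  (trans (*-congʳ N₀≈tW₀) (sym (tM-blocks i₀j₀∈s k l)))

          W-algebra : MultiplicativelyClosed (Span λ s → adj (F s) ∘ᴴ W)
          W-algebra A B A∈ B∈ = lower (const-resp (⊗e-⊠ A B) (const-⊠ (lift A∈) (lift B∈)))

-- Complex conjugation and positivity of norms.

module ComplexNumbers (ℝ : Reals) where
  open Configurations ℝ
  private
    module R = Reals ℝ
    module RO = IsStrictTotalOrder R.isStrictTotalOrder
    module RP = RingProperties R.ring
    module RA = AbelianGroupProperties R.+-abelianGroup
  module K = CommutativeRing ℂ-commutativeRing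

  -- Equality of reals is decided by the trichotomy of their order.
  _≈?_ : (x y : ℂ) → Dec (x ≈ y)
  (a , b) ≈? (c , d) = (a RO.≟ c) ×-dec (b RO.≟ d)

  private
    -- A disjunction in place of the negation of `<`, so that sums can be treated by cases.
    0≤_ : R.Carrier → Set
    0≤ x = R.0# R.< x ⊎ x R.≈ R.0#

    0<-resp : ∀ {x y} → x R.≈ y → R.0# R.< x → R.0# R.< y
    0<-resp = RO.<-respʳ-≈

    0≤-resp : ∀ {x y} → x R.≈ y → 0≤ x → 0≤ y
    0≤-resp x≈y (inj₁ p) = inj₁ (0<-resp x≈y p)
    0≤-resp x≈y (inj₂ p) = inj₂ (R.trans (R.sym x≈y) p)

    0<+0≤ : ∀ {x y} → R.0# R.< x → 0≤ y → R.0# R.< x R.+ y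
    0<+0≤ {x} {y} 0<x (inj₁ 0<y) =
      RO.trans 0<y (RO.<-respˡ-≈ (R.+-identityˡ y) (R.+-monoˡ-< y 0<x))
    0<+0≤ {x} 0<x (inj₂ y≈0) =
      0<-resp (R.sym (R.trans (R.+-congˡ y≈0) (R.+-identityʳ x))) 0<x

    0≤+0≤ : ∀ {x y} → 0≤ x → 0≤ y → 0≤ (x R.+ y)
    0≤+0≤ (inj₁ 0<x) 0≤y = inj₁ (0<+0≤ 0<x 0≤y)
    0≤+0≤ {x} {y} (inj₂ x≈0) 0≤y =
      0≤-resp (R.sym (R.trans (R.+-congʳ x≈0) (R.+-identityˡ y))) 0≤y

    0≤+0< : ∀ {x y} → 0≤ x → R.0# R.< y → R.0# R.< x R.+ y
    0≤+0< {x} {y} 0≤x 0<y = 0<-resp (R.+-comm y x) (0<+0≤ 0<y 0≤x)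

    -x*-x≈x*x : ∀ x → (R.- x) R.* (R.- x) R.≈ x R.* x
    -x*-x≈x*x x = R.trans (R.sym (RP.-‿distribˡ-* x (R.- x)))
      (R.trans (R.-‿cong (R.sym (RP.-‿distribʳ-* x x))) (RA.⁻¹-involutive (x R.* x)))

    x≉0⇒0<x*x : ∀ {x} → ¬ (x R.≈ R.0#) → R.0# R.< x R.* x
    x≉0⇒0<x*x {x} x≉0 with RO.compare R.0# x
    ... | tri< 0<x _ _ = R.*-pos 0<x 0<x
    ... | tri≈ _ 0≈x _ = contradiction (R.sym 0≈x) x≉0
    ... | tri> _ _ x<0 = 0<-resp (-x*-x≈x*x x) (R.*-pos 0<-x 0<-x)
      where
      0<-x : R.0# R.< R.- x
      0<-x = RO.<-respˡ-≈ (R.-‿inverseʳ x)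
        (RO.<-respʳ-≈ (R.+-identityˡ (R.- x)) (R.+-monoˡ-< (R.- x) x<0))

    0≤x*x : ∀ x → 0≤ (x R.* x)
    0≤x*x x with x RO.≟ R.0#
    ... | yes x≈0 = inj₂ (R.trans (R.*-congʳ x≈0) (R.zeroˡ x))
    ... | no x≉0 = inj₁ (x≉0⇒0<x*x x≉0)

    x-y*-y : ∀ x y → x R.* x R.+ (R.- (y R.* (R.- y))) R.≈ x R.* x R.+ y R.* y
    x-y*-y x y = R.+-congˡ (R.trans (RP.-‿distribˡ-* y (R.- y)) (-x*-x≈x*x y))

  infix 8 _̄
  _̄ : ℂ → ℂ
  (a , b) ̄ = a , R.- b

  ̄-cong : ∀ {x y} → x ≈ y → x ̄ ≈ y ̄
  ̄-cong (p , q) = p , R.-‿cong q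

  ̄-involutive : ∀ x → x ̄ ̄ ≈ x
  ̄-involutive (a , b) = R.refl , RA.⁻¹-involutive b

  ̄-0 : 0# ̄ ≈ 0#
  ̄-0 = R.refl , RA.ε⁻¹≈ε

  ̄-+ : ∀ x y → (x + y) ̄ ≈ x ̄ + y ̄
  ̄-+ (a , b) (c , d) = R.refl , R.sym (RA.⁻¹-∙-comm b d)

  ̄-* : ∀ x y → (x * y) ̄ ≈ x ̄ * y ̄
  ̄-* (a , b) (c , d) =
    R.+-congˡ (R.-‿cong (R.sym (R.trans (R.sym (RP.-‿distribˡ-* b (R.- d)))
      (R.trans (R.-‿cong (R.sym (RP.-‿distribʳ-* b d))) (RA.⁻¹-involutive (b R.* d)))))) ,
    R.trans (R.sym (RA.⁻¹-∙-comm (a R.* d) (b R.* c)))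
      (R.+-cong (RP.-‿distribʳ-* a d) (RP.-‿distribˡ-* b c))

  -- Only real parts are followed: a complex number with positive real part is already non-zero.
  NonNegativeRe PositiveRe : ℂ → Set
  NonNegativeRe (a , _) = 0≤ a
  PositiveRe (a , _) = R.0# R.< a

  positiveRe⇒≉0 : ∀ {x} → PositiveRe x → x ≉ 0#
  positiveRe⇒≉0 p (q , _) = RO.irrefl (R.sym q) p

  sum-nonNegativeRe : ∀ {k} (f : Fin k → ℂ) → (∀ i → NonNegativeRe (f i)) →
                      NonNegativeRe (sum f)
  sum-nonNegativeRe {zero} f nn = inj₂ R.refl
  sum-nonNegativeRe {suc k} f nn = 0≤+0≤ (nn zero) (sum-nonNegativeRe (f ∘ suc) (nn ∘ suc))

  sum-positiveRe : ∀ {k} (f : Fin k → ℂ) → (∀ i → NonNegativeRe (f i)) →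
                   ∀ i → PositiveRe (f i) → PositiveRe (sum f)
  sum-positiveRe f nn zero p = 0<+0≤ p (sum-nonNegativeRe (f ∘ suc) (nn ∘ suc))
  sum-positiveRe f nn (suc i) p = 0≤+0< (nn zero) (sum-positiveRe (f ∘ suc) (nn ∘ suc) i p)

  x*x̄-nonNegativeRe : ∀ x → NonNegativeRe (x * x ̄)
  x*x̄-nonNegativeRe (a , b) =
    0≤-resp (R.sym (x-y*-y a b)) (0≤+0≤ (0≤x*x a) (0≤x*x b))

  x*x̄-positiveRe : ∀ x → x ≉ 0# → PositiveRe (x * x ̄)
  x*x̄-positiveRe (a , b) x≉0 = 0<-resp (R.sym (x-y*-y a b)) 0<a²+b²
    where
    0<a²+b² : R.0# R.< a R.* a R.+ b R.* b
    0<a²+b² with a RO.≟ R.0#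
    ... | no a≉0 = 0<+0≤ (x≉0⇒0<x*x a≉0) (0≤x*x b)
    ... | yes a≈0 = 0≤+0< (0≤x*x a) (x≉0⇒0<x*x (λ b≈0 → x≉0 (a≈0 , b≈0)))

  -- The inverse is the conjugate divided by the norm: `w` inverts the real part `N` of `x * x ̄`,
  -- whose imaginary part `I` is zero.
  invertible : ∀ x → x ≉ 0# → ∃ λ y → x * y ≈ 1#
  invertible x@(a , b) x≉0 with R.inverse N (λ N≈0 → RO.irrefl (R.sym N≈0) (x*x̄-positiveRe x x≉0))
    where N = proj₁ (x * x ̄)
  ... | w , Nw≈1 = x ̄ * (w , R.0#) , K.trans (K.sym (K.*-assoc x (x ̄) (w , R.0#))) (re , im)
    where
    N I : R.Carrier
    N = proj₁ (x * x ̄)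
    I = proj₂ (x * x ̄)
    I≈0 : I R.≈ R.0#
    I≈0 = R.trans (R.+-cong (R.sym (RP.-‿distribʳ-* a b)) (R.*-comm b a))
                  (R.-‿inverseˡ (a R.* b))
    re : N R.* w R.+ (R.- (I R.* R.0#)) R.≈ R.1#
    re = R.trans (R.+-cong Nw≈1 (R.trans (R.-‿cong (R.zeroʳ I)) RA.ε⁻¹≈ε)) (R.+-identityʳ R.1#)
    im : N R.* R.0# R.+ I R.* w R.≈ R.0#
    im = R.trans (R.+-cong (R.zeroʳ N) (R.trans (R.*-congʳ I≈0) (R.zeroˡ w))) (R.+-identityʳ R.0#)

  conjugationField : ConjugationField
  conjugationField = record
    { commutativeRing = ℂ-commutativeRing
    ; _≈?_            = _≈?_
    ; 1≉0             = λ (1≈0 , _) → RO.irrefl (R.sym 1≈0) R.0<1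
    ; inverse         = invertible
    ; _̄               = _̄
    ; ̄-cong           = ̄-cong
    ; ̄-involutive     = ̄-involutive
    ; ̄-0              = ̄-0
    ; ̄-1              = 1-real
    ; ̄-+              = ̄-+
    ; ̄-*              = ̄-*
    -- One non-zero `f i` would make the real part of the sum positive, as every other term has
    -- non-negative real part.
    ; anisotropic     = λ f s≈0 i → decidable-stable (f i ≈? 0#) λ fi≉0 →
        positiveRe⇒≉0 (sum-positiveRe (λ j → f j * f j ̄) (λ j → x*x̄-nonNegativeRe (f j)) i
          (x*x̄-positiveRe (f i) fi≉0)) s≈0
    }
    where
    1-real : 1# ̄ ≈ 1#
    1-real = R.refl , RA.ε⁻¹≈ε

-- Specialisation to ℂ and to the algebra of the closed subset.

theorem4p2 : (ℝ : Reals) → let open Configurations ℝ in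
    ∀ {n r : ℕ} (C : Fin r → Relation n) → IsHomogeneousCC C →
    (D : Subset r) → IsClosed C D →
    ∀ {m ℓ : ℕ} (β : (Fin m × Fin ℓ) ↔ Fin n) → AreCosets β C D →
    (φ : Matrix n → ℂ) → IsIrreducibleCharacter (subsetAlgebra C D) φ →
    (∀ i → HasMultiplicity (subsetAlgebra C D) φ (standardCharacter β i) 1) →
    (eφ : Matrix n) → IsCentralPrimitiveIdempotentOf (subsetAlgebra C D) φ eφ →
    (e : Matrix ℓ) → (∀ i → block β eφ i i ≋ e) →
    (Γ : Matrix n → Matrix m) → IsΓ β C eφ e Γ →
    ∀ {q : ℕ} (rep : Fin q → Fin r) → AreRepresentatives β C eφ rep →
    let W : Matrix m
        W i j = sum (λ λ′ → Γ (eφ ⊠ adj (C (rep λ′)) ⊠ eφ) i j)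
        C//D : Fin q → Relation m
        C//D λ′ = factor β (C (rep λ′))
    in IsHomogeneousCC C//D × IsWeight C//D W
theorem4p2 ℝ {n} {r} C cc D closed {m} {ℓ} β cosets φ irr mult eφ cpi e blocks Γ isΓ {q} rep reps =
  record
    { nonempty  = F-nonempty
    ; covering  = F-covering
    ; disjoint  = F-disjoint
    ; transpose = F-transpose
    ; diagonal  = F-diagonal
    ; algebra   = F-algebra
    } ,
  record
    { support           = supportSet , W-support
    ; support-transpose = λ s s⊆support i j ji∈s → W-support-transpose (s⊆support j i ji∈s)
    ; diagonal          = W-diagonal
    ; algebra           = W-algebra
    }
  where
  open Configurations ℝ
  open IsHomogeneousCC cc
  open IsCentralPrimitiveIdempotent (IsCentralPrimitiveIdempotentOf.isCentralPrimitiveIdempotent cpi)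
  open IsCentralIdempotent
  open AreRepresentatives reps
  𝔽 : ConjugationField
  𝔽 = ComplexNumbers.conjugationField ℝ
  open Schemes 𝔽 using (module Configuration)
  open Configuration C nonempty covering disjoint transpose diagonal algebra
    using (module Factor; const-adj; ConstantOnClasses⇒Span)
  open Factor β D cosets
    using (InD; SpanOn⇒InD; InD⇒SpanOn; InD-⊠; InD-⊟; InD-†; module Representatives)
  open Representatives rep complete irredundant
    using (F-nonempty; F-covering; F-disjoint; F-transpose; F-diagonal; F-algebra; module Weight)
  module CI = CentralIdempotents 𝔽 InD InD-⊠ InD-⊟ InD-†

  -- Primitivity is given for idempotents of `subsetAlgebra C D`, whereas the splitting of E lives
  -- in `InD`; the translation is needed in both directions because centrality quantifies over the
  -- algebra.
  toInD : ∀ {f} → IsCentralIdempotent (subsetAlgebra C D) f → CI.CentralIdempotent f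
  toInD f-ci = record
    { member     = SpanOn⇒InD (f-ci .member)
    ; central    = λ A A∈ → f-ci .central A (InD⇒SpanOn A∈)
    ; idempotent = f-ci .idempotent
    }

  fromInD : ∀ {f} → CI.CentralIdempotent f → IsCentralIdempotent (subsetAlgebra C D) f
  fromInD f-ci = record
    { member     = InD⇒SpanOn (CI.CentralIdempotent.member f-ci)
    ; central    = λ A A∈ → CI.CentralIdempotent.central f-ci A (SpanOn⇒InD A∈)
    ; idempotent = CI.CentralIdempotent.idempotent f-ci
    }

  eφ-ci : CI.CentralIdempotent eφ
  eφ-ci = toInD isCentralIdempotent

  open Weight eφ (CI.CentralIdempotent.member eφ-ci) (CI.CentralIdempotent.idempotent eφ-ci)
    (CI.primitive⇒hermitian eφ-ci nonzero λ f g f-ci g-ci →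
      indecomposable f g (fromInD f-ci) (fromInD g-ci))
    nonzero e blocks (λ c → Γ (eφ ⊠ adj (C c) ⊠ eφ))
    (λ c → isΓ (eφ ⊠ adj (C c) ⊠ eφ)
      (adj (C c) , ConstantOnClasses⇒Span (const-adj c) , λ _ _ → ConjugationField.refl 𝔽))
    nonvanishing
    using (supportSet; W-support; W-support-transpose; W-diagonal; W-algebra)
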